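{- For every integer $k \geq 2$ there is an undirected Cayley graph on four generators of a cyclic group which has diameter $k$ and order $L(8,k)$, where \[ L(8,k)= \begin{cases} (k^4+2k^3+6k^2+4k)/2 &\mbox{ if } k\equiv 0 \pmod 2,\\ (k^4+2k^3+6k^2+6k+1)/2 &\mbox{ if } k\equiv 1 \pmod 2. \end{cases} \] Moreover, such a graph is the Cayley graph of $\mathbb{Z}_{L(8,k)}$ with generator set $\{1,\ (k^3+2k^2+6k+2)/2,\ (k^4+4k^2-8k)/4,\ (k^4+4k^2-4k)/4\}$ when $k \equiv 0 \pmod 2$, and with generator set $\{1,\ (k^3+k^2+5k+3)/2,\ (k^4+2k^2-8k-11)/4,\ (k^4+2k^2-4k-7)/4\}$ when $k \equiv 1 \pmod 2$.
   Context: For a positive integer $n$ and elements $g_1,\dots,g_4 \in \mathbb{Z}_n$ (the cyclic group of integers modulo $n$), the undirected Cayley graph (circulant graph) of $\mathbb{Z}_n$ with generator set $\{g_1,\dots,g_4\}$ has vertex set $\mathbb{Z}_n$, with vertices $x$ and $y$ adjacent whenever $y - x \in \{\pm g_1, \pm g_2, \pm g_3, \pm g_4\}$. Its order is $n$, and its diameter is the maximum over all pairs of vertices of the length of a shortest path between them. -}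

module Defs where

open import Data.Nat using (ℕ; zero; suc; _+_; _*_; _∸_; _^_; _≤_; _%_; _/_)
open import Data.Fin using (Fin; toℕ)
open import Data.Vec using (Vec; _∷_; [])
open import Data.Vec.Membership.Propositional using (_∈_)
open import Data.Product using (_×_; ∃-syntax)
open import Data.Sum using (_⊎_)
open import Relation.Binary.PropositionalEquality using (_≡_)

_≡[mod_]_ : ℕ → ℕ → ℕ → Set
a ≡[mod n ] b = ∃[ c ] ∃[ d ] (a + c * n ≡ b + d * n)

-- Vertices of the circulant graph Cay(Z_n, {g₁,…,g₄}) are Fin n (residues 0..n-1).
-- A generator g ∈ Z_n is given by a natural number representative (taken mod n).
-- x ~ y  iff  y - x ≡ ± g (mod n) for some generator g.
Adj : (n : ℕ) → Vec ℕ 4 → Fin n → Fin n → Set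
Adj n gs x y = ∃[ g ] (g ∈ gs × ((toℕ x + g) ≡[mod n ] toℕ y ⊎ (toℕ y + g) ≡[mod n ] toℕ x))

data Walk (n : ℕ) (gs : Vec ℕ 4) : ℕ → Fin n → Fin n → Set where
  nil  : ∀ {x} → Walk n gs 0 x x
  step : ∀ {m x y z} → Adj n gs x y → Walk n gs m y z → Walk n gs (suc m) x z

HasDiameter : (n : ℕ) → Vec ℕ 4 → ℕ → Set
HasDiameter n gs d =
  (∀ x y → ∃[ m ] (m ≤ d × Walk n gs m x y)) ×
  (∃[ x ] ∃[ y ] (∀ m → Walk n gs m x y → d ≤ m))

L-by-parity : ℕ → ℕ → ℕ
L-by-parity zero    k = (k ^ 4 + 2 * k ^ 3 + 6 * k ^ 2 + 4 * k) / 2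
L-by-parity (suc _) k = (k ^ 4 + 2 * k ^ 3 + 6 * k ^ 2 + 6 * k + 1) / 2

L8 : ℕ → ℕ
L8 k = L-by-parity (k % 2) k

gens-by-parity : ℕ → ℕ → Vec ℕ 4
gens-by-parity zero k =
  1 ∷ (k ^ 3 + 2 * k ^ 2 + 6 * k + 2) / 2
    ∷ (k ^ 4 + 4 * k ^ 2 ∸ 8 * k) / 4
    ∷ (k ^ 4 + 4 * k ^ 2 ∸ 4 * k) / 4 ∷ []
gens-by-parity (suc _) k =
  1 ∷ (k ^ 3 + k ^ 2 + 5 * k + 3) / 2
    ∷ (k ^ 4 + 2 * k ^ 2 ∸ (8 * k + 11)) / 4
    ∷ (k ^ 4 + 2 * k ^ 2 ∸ (4 * k + 7)) / 4 ∷ []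

gens8 : ℕ → Vec ℕ 4
gens8 k = gens-by-parity (k % 2) k

{-# OPTIONS --safe #-}
-- Put k = 2a, b = a + 1 or k = 2a − 1, b = a according to parity, and h = 2a(b − 1) + 2, z = bh + a − 1,
-- so that L(8,k) = 2a · 2z.
--
-- Every vertex is within distance k of 0: the vertices e₁g₁ + … + e₄g₄ with ∣e₁∣ + … + ∣e₄∣ ≤ k contain 0 and are
-- closed under adding the generator g₁ = 1.  Indeed, if this leads to a vector e of norm k + 1, then e₁ ≥ 1, and some
-- relation between the generators, a combination with coefficients 0, ±1 of four relations that are close to
-- (±a, ±a, ±a, ±a), can be subtracted from e to get a vector of norm at most k.  The choice of the relation depends
-- on the position of e with respect to finitely many thresholds αa + β; each case is a system of linear inequalities
-- in a and e, uniformly in a, which is settled by Farkas certificates.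
--
-- The vertex z is not within distance k − 1 of 0: modulo 2z the generators become, up to sign and order, 1, ±1, h and
-- h + 2a, and no combination of 1, h and h + 2a with norm less than k = a + b − 1 is an odd multiple of z.
module Submission where

open import Defs
open import Algebra.Properties.CommutativeSemigroup using (interchange)
open import Data.Bool using (Bool; true; false; T; _∧_)
open import Data.Bool.Properties using (T-∧)
open import Data.Empty using (⊥; ⊥-elim)
open import Data.Fin using (Fin; zero; suc; toℕ; fromℕ<)
open import Data.Fin.Properties using (toℕ-injective; toℕ-fromℕ<; toℕ<n)
open import Data.Integer using (ℤ; +_; -[1+_]; +[1+_]; -≤+; +≤+; 0ℤ; 1ℤ; -1ℤ; ∣_∣; -_; _+_; _*_; _-_; _%ℕ_; _/ℕ_)
  renaming (_≤_ to _≤ᶻ_)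
open import Data.Integer.DivMod using (n%ℕd<d; a≡a%ℕn+[a/ℕn]*n)
open import Data.Integer.Divisibility.Signed using (_∣_; divides; ∣-refl; ∣-trans; ∣m⇒∣-m; ∣n⇒∣m*n; ∣m∣n⇒∣m+n; ∣m∣n⇒∣m-n)
open import Data.Integer.Properties
open import Data.Integer.Solver using (module +-*-Solver)
open import Data.List using (List; []; _∷_)
open import Data.List.Relation.Unary.All using (All; []; _∷_)
open import Data.Nat as ℕ using (ℕ; zero; suc; _≤_; _<_; z≤n; s≤s; NonZero)
open import Data.Nat.DivMod using (m≡m%n+[m/n]*n; m%n<n; m<n⇒m%n≡m; m*n%n≡0; m*n/n≡m; [m+kn]%n≡m%n)
import Data.Nat.Properties as ℕ
import Data.Nat.Solver
open import Data.Product using (_×_; _,_; ∃-syntax)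
open import Data.Sum using (_⊎_; inj₁; inj₂; [_,_]′)
open import Data.Unit using (tt)
open import Data.Vec using (Vec; []; _∷_; map; zipWith; replicate; lookup; tabulate)
open import Data.Vec.Membership.Propositional using (_∈_)
open import Data.Vec.Properties using (tabulate-∘; tabulate-cong; tabulate∘lookup)
open import Data.Vec.Relation.Unary.Any using (here; there)
import Data.Vec.Relation.Unary.All as V
open import Function using (_∘_; Equivalence)
open import Relation.Binary.PropositionalEquality using (_≡_; refl; sym; trans; cong; cong₂; subst; subst₂)

-- Closed forms of the order and the generators.

module Formulas where
  open Data.Nat.Solver.+-*-Solver using (Polynomial; solve; _:+_; _:*_; _:^_; _:=_; con)

  -- Coefficients stand lowest first. Writing everything in c, where k = 2c + 2 or k = 2c + 3, gives
  -- natural coefficients, so that neither division nor truncated subtraction remains.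
  poly : List ℕ → ℕ → ℕ
  poly []       x = 0
  poly (c ∷ cs) x = c ℕ.+ x ℕ.* poly cs x

  polyˢ : ∀ {n} → List ℕ → Polynomial n → Polynomial n
  polyˢ []       x = con 0
  polyˢ (c ∷ cs) x = con c :+ x :* polyˢ cs x

  -- The hypothesis makes the truncated subtraction exact: the subtrahend splits off as a summand.
  quarter : ∀ {m n} l → m ≡ n ℕ.* 4 ℕ.+ l → (m ℕ.∸ l) ℕ./ 4 ≡ n
  quarter {n = n} l refl = trans (cong (ℕ._/ 4) (ℕ.m+n∸n≡m (n ℕ.* 4) l)) (m*n/n≡m n 4)

  module EvenFormulas (c : ℕ) where

    orderᶜ g₂ᶜ g₃ᶜ g₄ᶜ : List ℕ
    -- The non-zero constant term makes `order` a successor by computation, which later provides the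
    -- `NonZero` instance.
    orderᶜ = 32 ∷ 84 ∷ 84 ∷ 40 ∷ 8 ∷ []
    g₂ᶜ = 15 ∷ 26 ∷ 16 ∷ 4 ∷ []
    g₃ᶜ = 4 ∷ 20 ∷ 28 ∷ 16 ∷ 4 ∷ []
    g₄ᶜ = 6 ∷ 22 ∷ 28 ∷ 16 ∷ 4 ∷ []

    k order : ℕ
    k = suc c ℕ.* 2
    order = poly orderᶜ c

    gens : Vec ℕ 3
    gens = poly g₂ᶜ c ∷ poly g₃ᶜ c ∷ poly g₄ᶜ c ∷ []

    L8-k : L8 k ≡ order
    L8-k = trans (cong (λ r → L-by-parity r k) (m*n%n≡0 (suc c) 2)) (trans (cong (ℕ._/ 2) eq) (m*n/n≡m order 2))
      where
      eq : k ℕ.^ 4 ℕ.+ 2 ℕ.* k ℕ.^ 3 ℕ.+ 6 ℕ.* k ℕ.^ 2 ℕ.+ 4 ℕ.* k ≡ order ℕ.* 2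
      eq = solve 1 (λ c → let k = (con 1 :+ c) :* con 2 in k :^ 4 :+ con 2 :* k :^ 3 :+ con 6 :* k :^ 2 :+ con 4 :* k
        := polyˢ orderᶜ c :* con 2) refl c

    gens8-k : gens8 k ≡ 1 ∷ gens
    gens8-k = trans (cong (λ r → gens-by-parity r k) (m*n%n≡0 (suc c) 2))
      (cong₂ (λ x y → 1 ∷ x ∷ y) (trans (cong (ℕ._/ 2) eq₂) (m*n/n≡m _ 2))
        (cong₂ (λ x y → x ∷ y ∷ []) (quarter (8 ℕ.* k) eq₃) (quarter (4 ℕ.* k) eq₄)))
      where
      eq₂ : k ℕ.^ 3 ℕ.+ 2 ℕ.* k ℕ.^ 2 ℕ.+ 6 ℕ.* k ℕ.+ 2 ≡ poly g₂ᶜ c ℕ.* 2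
      eq₂ = solve 1 (λ c → let k = (con 1 :+ c) :* con 2 in k :^ 3 :+ con 2 :* k :^ 2 :+ con 6 :* k :+ con 2
        := polyˢ g₂ᶜ c :* con 2) refl c
      eq₃ : k ℕ.^ 4 ℕ.+ 4 ℕ.* k ℕ.^ 2 ≡ poly g₃ᶜ c ℕ.* 4 ℕ.+ 8 ℕ.* k
      eq₃ = solve 1 (λ c → let k = (con 1 :+ c) :* con 2 in k :^ 4 :+ con 4 :* k :^ 2
        := polyˢ g₃ᶜ c :* con 4 :+ con 8 :* k) refl c
      eq₄ : k ℕ.^ 4 ℕ.+ 4 ℕ.* k ℕ.^ 2 ≡ poly g₄ᶜ c ℕ.* 4 ℕ.+ 4 ℕ.* k
      eq₄ = solve 1 (λ c → let k = (con 1 :+ c) :* con 2 in k :^ 4 :+ con 4 :* k :^ 2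
        := polyˢ g₄ᶜ c :* con 4 :+ con 4 :* k) refl c

  module OddFormulas (c : ℕ) where

    orderᶜ g₂ᶜ g₃ᶜ g₄ᶜ : List ℕ
    orderᶜ = 104 ∷ 204 ∷ 156 ∷ 56 ∷ 8 ∷ []
    g₂ᶜ = 27 ∷ 38 ∷ 20 ∷ 4 ∷ []
    g₃ᶜ = 16 ∷ 56 ∷ 56 ∷ 24 ∷ 4 ∷ []
    g₄ᶜ = 20 ∷ 58 ∷ 56 ∷ 24 ∷ 4 ∷ []

    k order : ℕ
    k = suc (suc c ℕ.* 2)
    order = poly orderᶜ c

    gens : Vec ℕ 3
    gens = poly g₂ᶜ c ∷ poly g₃ᶜ c ∷ poly g₄ᶜ c ∷ []

    L8-k : L8 k ≡ order
    L8-k = trans (cong (λ r → L-by-parity r k) ([m+kn]%n≡m%n 1 (suc c) 2)) (trans (cong (ℕ._/ 2) eq) (m*n/n≡m order 2))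
      where
      eq : k ℕ.^ 4 ℕ.+ 2 ℕ.* k ℕ.^ 3 ℕ.+ 6 ℕ.* k ℕ.^ 2 ℕ.+ 6 ℕ.* k ℕ.+ 1 ≡ order ℕ.* 2
      eq = solve 1 (λ c → let k = con 1 :+ (con 1 :+ c) :* con 2 in k :^ 4 :+ con 2 :* k :^ 3 :+ con 6 :* k :^ 2 :+ con 6 :* k :+ con 1
        := polyˢ orderᶜ c :* con 2) refl c

    gens8-k : gens8 k ≡ 1 ∷ gens
    gens8-k = trans (cong (λ r → gens-by-parity r k) ([m+kn]%n≡m%n 1 (suc c) 2))
      (cong₂ (λ x y → 1 ∷ x ∷ y) (trans (cong (ℕ._/ 2) eq₂) (m*n/n≡m _ 2))
        (cong₂ (λ x y → x ∷ y ∷ []) (quarter (8 ℕ.* k ℕ.+ 11) eq₃) (quarter (4 ℕ.* k ℕ.+ 7) eq₄)))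
      where
      eq₂ : k ℕ.^ 3 ℕ.+ k ℕ.^ 2 ℕ.+ 5 ℕ.* k ℕ.+ 3 ≡ poly g₂ᶜ c ℕ.* 2
      eq₂ = solve 1 (λ c → let k = con 1 :+ (con 1 :+ c) :* con 2 in k :^ 3 :+ k :^ 2 :+ con 5 :* k :+ con 3
        := polyˢ g₂ᶜ c :* con 2) refl c
      eq₃ : k ℕ.^ 4 ℕ.+ 2 ℕ.* k ℕ.^ 2 ≡ poly g₃ᶜ c ℕ.* 4 ℕ.+ (8 ℕ.* k ℕ.+ 11)
      eq₃ = solve 1 (λ c → let k = con 1 :+ (con 1 :+ c) :* con 2 in k :^ 4 :+ con 2 :* k :^ 2
        := polyˢ g₃ᶜ c :* con 4 :+ (con 8 :* k :+ con 11)) refl c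
      eq₄ : k ℕ.^ 4 ℕ.+ 2 ℕ.* k ℕ.^ 2 ≡ poly g₄ᶜ c ℕ.* 4 ℕ.+ (4 ℕ.* k ℕ.+ 7)
      eq₄ = solve 1 (λ c → let k = con 1 :+ (con 1 :+ c) :* con 2 in k :^ 4 :+ con 2 :* k :^ 2
        := polyˢ g₄ᶜ c :* con 4 :+ (con 4 :* k :+ con 7)) refl c

open Formulas
open +-*-Solver using (Polynomial; solve; _:+_; _:*_; _:-_; :-_; _:=_; con)

-- Sign arithmetic over the integers.

infixl 6 _⊞_
infixl 7 _⊠_

_⊞_ : ∀ {i j} → 0ℤ ≤ᶻ i → 0ℤ ≤ᶻ j → 0ℤ ≤ᶻ i + j
_⊞_ = +-mono-≤

_⊠_ : ∀ {i j} → 0ℤ ≤ᶻ i → 0ℤ ≤ᶻ j → 0ℤ ≤ᶻ i * j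
_⊠_ {+ m} {j} _ 0≤j = subst (_≤ᶻ + m * j) (*-zeroʳ (+ m)) (*-monoˡ-≤-nonNeg (+ m) 0≤j)

nonneg : ∀ n → 0ℤ ≤ᶻ + n
nonneg n = +≤+ z≤n

-- Closes a certificate: a sum of non-negative terms which the ring solver evaluates to a negative
-- constant.
negative : ∀ {i n} → 0ℤ ≤ᶻ i → i ≡ -[1+ n ] → ⊥
negative () refl

dichotomy : ∀ i → 0ℤ ≤ᶻ i - 1ℤ ⊎ 0ℤ ≤ᶻ - i
dichotomy (+ zero) = inj₂ (nonneg 0)
dichotomy +[1+ n ] = inj₁ (nonneg n)
dichotomy -[1+ n ] = inj₂ (nonneg (suc n))

0≤∣_∣ : ∀ i → 0ℤ ≤ᶻ + ∣ i ∣
0≤∣ i ∣ = nonneg ∣ i ∣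

i≤∣_∣ : ∀ i → i ≤ᶻ + ∣ i ∣
i≤∣ + n ∣ = ≤-refl
i≤∣ -[1+ n ] ∣ = -≤+

-i≤∣_∣ : ∀ i → - i ≤ᶻ + ∣ i ∣
-i≤∣ i ∣ = subst (λ n → - i ≤ᶻ + n) (∣-i∣≡∣i∣ i) i≤∣ - i ∣

-- Combinations of 1, h and h + 2a that are odd multiples of z.

isolate : ∀ a h {s} y₁ y₂ y₃ → y₁ + h * y₂ + (h + + 2 * a) * y₃ ≡ s → y₁ ≡ s - h * y₂ - (h + + 2 * a) * y₃
isolate a h y₁ y₂ y₃ refl = solve 5 (λ a h y₁ y₂ y₃ →
  y₁ := y₁ :+ h :* y₂ :+ (h :+ con (+ 2) :* a) :* y₃ :- h :* y₂ :- (h :+ con (+ 2) :* a) :* y₃) refl a h y₁ y₂ y₃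

-- As z = bh + a - 1, the level t = y₂ + y₃ - b counts the copies of h beyond the b copies in z. The
-- factor 2·0 + 1 is spelled out to match `avoids⁺` at 0.
recentre : ∀ a b h y₂ y₃ → (+ 2 * 0ℤ + 1ℤ) * (b * h + a - 1ℤ) - h * y₂ - (h + + 2 * a) * y₃ ≡
  a - 1ℤ - + 2 * a * y₃ - h * (y₂ + y₃ - b)
recentre = solve 5 (λ a b h y₂ y₃ →
  (con (+ 2) :* con 0ℤ :+ con 1ℤ) :* (b :* h :+ a :- con 1ℤ) :- h :* y₂ :- (h :+ con (+ 2) :* a) :* y₃
  := a :- con 1ℤ :- con (+ 2) :* a :* y₃ :- h :* (y₂ :+ y₃ :- b)) refl

-- Changing all signs exchanges the odd multiples of z with the indices -(1 + c) and c.
reflect : ∀ a h z c y₁ y₂ y₃ → y₁ + h * y₂ + (h + + 2 * a) * y₃ ≡ (+ 2 * - (1ℤ + c) + 1ℤ) * z →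
  - y₁ + h * - y₂ + (h + + 2 * a) * - y₃ ≡ (+ 2 * c + 1ℤ) * z
reflect a h z c y₁ y₂ y₃ eq = trans (trans
  (solve 5 (λ a h y₁ y₂ y₃ →
    :- y₁ :+ h :* :- y₂ :+ (h :+ con (+ 2) :* a) :* :- y₃ := :- (y₁ :+ h :* y₂ :+ (h :+ con (+ 2) :* a) :* y₃)) refl a h y₁ y₂ y₃)
  (cong -_ eq))
  (solve 2 (λ c z → :- ((con (+ 2) :* :- (con 1ℤ :+ c) :+ con 1ℤ) :* z) := (con (+ 2) :* c :+ con 1ℤ) :* z) refl c z)

height antipode : ℤ → ℤ → ℤ
height a b = + 2 * a * (b - 1ℤ) + + 2
antipode a b = b * height a b + a - 1ℤ

module Antipode (a b : ℤ) (1≤a : 0ℤ ≤ᶻ a - 1ℤ) (2≤b : 0ℤ ≤ᶻ b - + 2) (a≤b : 0ℤ ≤ᶻ b - a) where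

  h z : ℤ
  h = height a b
  z = antipode a b

  0≤a : 0ℤ ≤ᶻ a
  0≤a = subst (0ℤ ≤ᶻ_) (solve 1 (λ a → a :- con 1ℤ :+ con 1ℤ := a) refl a) (1≤a ⊞ nonneg 1)

  0≤b : 0ℤ ≤ᶻ b
  0≤b = subst (0ℤ ≤ᶻ_) (solve 1 (λ b → b :- con (+ 2) :+ con (+ 2) := b) refl b) (2≤b ⊞ nonneg 2)

  0≤h : 0ℤ ≤ᶻ h
  0≤h = subst (0ℤ ≤ᶻ_) (solve 2 (λ a b →
    con (+ 2) :* a :* (b :- con (+ 2) :+ con 1ℤ) :+ con (+ 2) := con (+ 2) :* a :* (b :- con 1ℤ) :+ con (+ 2)) refl a b)
    (nonneg 2 ⊠ 0≤a ⊠ (2≤b ⊞ nonneg 1) ⊞ nonneg 2)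

  0≤h-1 : 0ℤ ≤ᶻ h - 1ℤ
  0≤h-1 = subst (0ℤ ≤ᶻ_) (solve 2 (λ a b →
    con (+ 2) :* a :* (b :- con (+ 2) :+ con 1ℤ) :+ con 1ℤ := con (+ 2) :* a :* (b :- con 1ℤ) :+ con (+ 2) :- con 1ℤ) refl a b)
    (nonneg 2 ⊠ 0≤a ⊠ (2≤b ⊞ nonneg 1) ⊞ nonneg 1)

  0≤z : 0ℤ ≤ᶻ z
  0≤z = subst (0ℤ ≤ᶻ_) (solve 3 (λ a b h → b :* h :+ (a :- con 1ℤ) := b :* h :+ a :- con 1ℤ) refl a b h) (0≤b ⊠ 0≤h ⊞ 1≤a)

  -- `K` and `H` are the ring solver's expressions for k - 1 = a + b - 2 and for h.
  K : ∀ {n} → Polynomial n → Polynomial n → Polynomial n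
  K a b = a :+ b :- con (+ 2)

  H : ∀ {n} → Polynomial n → Polynomial n → Polynomial n
  H a b = con (+ 2) :* a :* (b :- con 1ℤ) :+ con (+ 2)

  -- With k = a + b - 1 this is p + q + r ≤ k - 1. The case lemmas take for p, q, r zero or a signed
  -- coordinate, a lower bound for the absolute value, so that their estimates are polynomial.
  Short : ℤ → ℤ → ℤ → Set
  Short p q r = 0ℤ ≤ᶻ a + b - + 2 - p - q - r

  -- When y₁ + h y₂ + (h + 2a) y₃ = z, the number t = y₂ + y₃ − b determines y₁ and y₂ from y = y₃.  The cases for t
  -- are closed by adding up products of non-negative quantities to a negative constant.
  above-level : ∀ y t → let y₁ = a - 1ℤ - + 2 * a * y - h * t; y₂ = b + t - y in
    Short 0ℤ y₂ (- y) → Short (- y₁) y₂ (- y) → 0ℤ ≤ᶻ t - 1ℤ → ⊥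
  above-level y t s s′ 1≤t = negative
    -- `s` bounds y from below, which makes -y₁ too large; the factor a - 1 of `s` eliminates y.
    (1≤a ⊠ s ⊞ s′ ⊞ 0≤a ⊠ (1≤t ⊞ nonneg 1) ⊞ 0≤h ⊠ 1≤t ⊞ nonneg 2 ⊠ 0≤a ⊠ a≤b ⊞ 0≤a ⊠ 1≤a)
    (solve 4 (λ a b y t →
      let y₁ = a :- con 1ℤ :- con (+ 2) :* a :* y :- H a b :* t; y₂ = b :+ t :- y in
      (a :- con 1ℤ) :* (K a b :- con 0ℤ :- y₂ :- :- y) :+ (K a b :- :- y₁ :- y₂ :- :- y)
        :+ a :* (t :- con 1ℤ :+ con 1ℤ) :+ H a b :* (t :- con 1ℤ) :+ con (+ 2) :* a :* (b :- a) :+ a :* (a :- con 1ℤ)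
      := con -[1+ 2 ]) refl a b y t)

  -- Here `s` bounds y from above, which makes y₁ too large; again the factor a - 1 eliminates y.
  below-level : ∀ y t → let y₁ = a - 1ℤ - + 2 * a * y - h * t; y₂ = b + t - y in
    Short 0ℤ (- y₂) y → Short y₁ (- y₂) y → 0ℤ ≤ᶻ - t - 1ℤ - 1ℤ → ⊥
  below-level y t s s′ t≤-2 = negative
    (1≤a ⊠ s ⊞ s′ ⊞ (0≤a ⊞ 0≤h) ⊠ t≤-2 ⊞ 0≤a ⊠ a≤b ⊞ 0≤a ⊠ 0≤b ⊞ 0≤a)
    (solve 4 (λ a b y t →
      let y₁ = a :- con 1ℤ :- con (+ 2) :* a :* y :- H a b :* t; y₂ = b :+ t :- y in
      (a :- con 1ℤ) :* (K a b :- con 0ℤ :- :- y₂ :- y) :+ (K a b :- y₁ :- :- y₂ :- y)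
        :+ (a :+ H a b) :* (:- t :- con 1ℤ :- con 1ℤ) :+ a :* (b :- a) :+ a :* b :+ a
      := con -[1+ 2 ]) refl a b y t)

  -- At t = 0 one has y₁ = a - 1 - 2ay and y₂ = b - y. For y ≤ 0 the norm is at least k, with
  -- equality at y = 0; for y ≥ 1 it is at least k + 2.
  on-level : ∀ y t → let y₁ = a - 1ℤ - + 2 * a * y - h * t; y₂ = b + t - y in
    Short y₁ y₂ y → Short (- y₁) y₂ y → 0ℤ ≤ᶻ - t → 0ℤ ≤ᶻ - - t → ⊥
  on-level y t s s′ t≤0 0≤t = [ case₁ , case₂ ]′ (dichotomy y)
    where
    case₁ : 0ℤ ≤ᶻ y - 1ℤ → ⊥
    case₁ 1≤y = negative
      (s′ ⊞ nonneg 2 ⊠ 0≤a ⊠ 1≤y ⊞ (0≤h ⊞ nonneg 1) ⊠ 0≤t)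
      (solve 4 (λ a b y t →
        let y₁ = a :- con 1ℤ :- con (+ 2) :* a :* y :- H a b :* t; y₂ = b :+ t :- y in
        (K a b :- :- y₁ :- y₂ :- y) :+ con (+ 2) :* a :* (y :- con 1ℤ) :+ (H a b :+ con 1ℤ) :* :- :- t
        := con -[1+ 2 ]) refl a b y t)
    case₂ : 0ℤ ≤ᶻ - y → ⊥
    case₂ y≤0 = negative
      (s ⊞ nonneg 2 ⊠ 0≤a ⊠ y≤0 ⊞ 0≤h ⊠ t≤0 ⊞ 0≤t)
      (solve 4 (λ a b y t →
        let y₁ = a :- con 1ℤ :- con (+ 2) :* a :* y :- H a b :* t; y₂ = b :+ t :- y in
        (K a b :- y₁ :- y₂ :- y) :+ con (+ 2) :* a :* (:- y) :+ H a b :* :- t :+ :- :- t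
        := con -[1+ 0 ]) refl a b y t)

  -- At t = -1 the choice of h gives y₁ = a + 1 + 2a(b - 1 - y), which is positive for y ≤ b - 1 and
  -- at most 0 for y ≥ b. On either side the norm is at least a + b.
  one-below-level : ∀ y t → let y₁ = a - 1ℤ - + 2 * a * y - h * t; y₂ = b + t - y in
    Short y₁ (- y₂) y → Short (- y₁) (- y₂) y → 0ℤ ≤ᶻ - t - 1ℤ → 0ℤ ≤ᶻ - (- t - 1ℤ) → ⊥
  one-below-level y t s s′ t≤-1 -1≤t = [ case₁ , case₂ ]′ (dichotomy (b - y))
    where
    case₁ : 0ℤ ≤ᶻ b - y - 1ℤ → ⊥
    case₁ y<b = negative
      (s ⊞ nonneg 2 ⊠ 1≤a ⊠ y<b ⊞ (0≤h ⊞ nonneg 1) ⊠ t≤-1)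
      (solve 4 (λ a b y t →
        let y₁ = a :- con 1ℤ :- con (+ 2) :* a :* y :- H a b :* t; y₂ = b :+ t :- y in
        (K a b :- y₁ :- :- y₂ :- y) :+ con (+ 2) :* (a :- con 1ℤ) :* (b :- y :- con 1ℤ) :+ (H a b :+ con 1ℤ) :* (:- t :- con 1ℤ)
        := con -[1+ 1 ]) refl a b y t)
    case₂ : 0ℤ ≤ᶻ - (b - y) → ⊥
    case₂ b≤y = negative
      (s′ ⊞ nonneg 2 ⊠ (0≤a ⊞ nonneg 1) ⊠ b≤y ⊞ 0≤h ⊠ -1≤t ⊞ t≤-1)
      (solve 4 (λ a b y t →
        let y₁ = a :- con 1ℤ :- con (+ 2) :* a :* y :- H a b :* t; y₂ = b :+ t :- y in
        (K a b :- :- y₁ :- :- y₂ :- y) :+ con (+ 2) :* (a :+ con 1ℤ) :* :- (b :- y) :+ H a b :* :- (:- t :- con 1ℤ) :+ (:- t :- con 1ℤ)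
        := con -[1+ 1 ]) refl a b y t)

  -- The three bounds with the weights h - 1, 1 and 2a add up to y₁ + h y₂ + (h + 2a) y₃ ≤ (h +
  -- 2a)(k - 1), which is below 3z because a ≤ b.
  large-multiple : ∀ c y₂ y₃ → let y₁ = (+ 2 * c + 1ℤ) * z - h * y₂ - (h + + 2 * a) * y₃ in
    Short 0ℤ y₂ y₃ → Short y₁ y₂ y₃ → Short 0ℤ 0ℤ y₃ → 0ℤ ≤ᶻ c - 1ℤ → ⊥
  large-multiple c y₂ y₃ s s′ s″ 1≤c = negative
    (0≤h-1 ⊠ s ⊞ s′ ⊞ nonneg 2 ⊠ 0≤a ⊠ s″ ⊞ nonneg 2 ⊠ 1≤c ⊠ 0≤z ⊞ 0≤b ⊠ 0≤h ⊞ nonneg 3 ⊠ 0≤a ⊞ a≤b ⊠ (0≤h ⊞ nonneg 2 ⊠ 0≤a))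
    (solve 5 (λ a b y₂ y₃ c →
      let h = H a b; z = b :* h :+ a :- con 1ℤ
          y₁ = (con (+ 2) :* c :+ con 1ℤ) :* z :- h :* y₂ :- (h :+ con (+ 2) :* a) :* y₃ in
      (h :- con 1ℤ) :* (K a b :- con 0ℤ :- y₂ :- y₃) :+ (K a b :- y₁ :- y₂ :- y₃)
        :+ con (+ 2) :* a :* (K a b :- con 0ℤ :- con 0ℤ :- y₃) :+ con (+ 2) :* (c :- con 1ℤ) :* z
        :+ b :* h :+ con (+ 3) :* a :+ (b :- a) :* (h :+ con (+ 2) :* a)
      := con -[1+ 0 ]) refl a b y₂ y₃ c)

  Walkable : ℤ → ℤ → ℤ → Set
  Walkable y₁ y₂ y₃ = Short (+ ∣ y₁ ∣) (+ ∣ y₂ ∣) (+ ∣ y₃ ∣)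

  weaken : ∀ {p q r} y₁ y₂ y₃ → p ≤ᶻ + ∣ y₁ ∣ → q ≤ᶻ + ∣ y₂ ∣ → r ≤ᶻ + ∣ y₃ ∣ → Walkable y₁ y₂ y₃ → Short p q r
  weaken _ _ _ p q r s = ≤-trans s
    (+-mono-≤ (+-mono-≤ (+-monoʳ-≤ (a + b - + 2) (neg-mono-≤ p)) (neg-mono-≤ q)) (neg-mono-≤ r))

  level : ∀ y t {y₁ y₂} → y₁ ≡ a - 1ℤ - + 2 * a * y - h * t → y₂ ≡ b + t - y → Walkable y₁ y₂ y → ⊥
  level y t {y₁} {y₂} refl refl w =
    -- In the order of the brackets: t ≥ 1, t ≤ -2, t = -1, t = 0.
    [ above-level y t (short (0≤∣ y₁ ∣) (i≤∣ y₂ ∣) (-i≤∣ y ∣)) (short (-i≤∣ y₁ ∣) (i≤∣ y₂ ∣) (-i≤∣ y ∣))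
    , (λ t≤0 →
      [ (λ t<0 →
        [ below-level y t (short (0≤∣ y₁ ∣) (-i≤∣ y₂ ∣) (i≤∣ y ∣)) (short (i≤∣ y₁ ∣) (-i≤∣ y₂ ∣) (i≤∣ y ∣))
        , one-below-level y t (short (i≤∣ y₁ ∣) (-i≤∣ y₂ ∣) (i≤∣ y ∣)) (short (-i≤∣ y₁ ∣) (-i≤∣ y₂ ∣) (i≤∣ y ∣)) t<0
        ]′ (dichotomy (- t - 1ℤ)))
      , on-level y t (short (i≤∣ y₁ ∣) (i≤∣ y₂ ∣) (i≤∣ y ∣)) (short (-i≤∣ y₁ ∣) (i≤∣ y₂ ∣) (i≤∣ y ∣)) t≤0
      ]′ (dichotomy (- t)))
    ]′ (dichotomy t)
    where
    short : ∀ {p q r} → p ≤ᶻ + ∣ y₁ ∣ → q ≤ᶻ + ∣ y₂ ∣ → r ≤ᶻ + ∣ y ∣ → Short p q r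
    short p q r = weaken y₁ y₂ y p q r w

  avoids⁺ : ∀ c y₁ y₂ y₃ → y₁ + h * y₂ + (h + + 2 * a) * y₃ ≡ (+ 2 * + c + 1ℤ) * z → Walkable y₁ y₂ y₃ → ⊥
  avoids⁺ zero y₁ y₂ y₃ eq w = level y₃ (y₂ + y₃ - b)
    (trans (isolate a h y₁ y₂ y₃ eq) (recentre a b h y₂ y₃))
    (solve 3 (λ b y₂ y₃ → y₂ := b :+ (y₂ :+ y₃ :- b) :- y₃) refl b y₂ y₃) w
  avoids⁺ (suc c) y₁ y₂ y₃ eq w = large-multiple +[1+ c ] y₂ y₃ (short (0≤∣ y₁ ∣) (i≤∣ y₂ ∣) (i≤∣ y₃ ∣))
    (subst (λ y₁ → Short y₁ y₂ y₃) (isolate a h y₁ y₂ y₃ eq) (short (i≤∣ y₁ ∣) (i≤∣ y₂ ∣) (i≤∣ y₃ ∣)))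
    (short (0≤∣ y₁ ∣) (0≤∣ y₂ ∣) (i≤∣ y₃ ∣)) (nonneg c)
    where
    short : ∀ {p q r} → p ≤ᶻ + ∣ y₁ ∣ → q ≤ᶻ + ∣ y₂ ∣ → r ≤ᶻ + ∣ y₃ ∣ → Short p q r
    short p q r = weaken y₁ y₂ y₃ p q r w

  avoids : ∀ c y₁ y₂ y₃ → y₁ + h * y₂ + (h + + 2 * a) * y₃ ≡ (+ 2 * c + 1ℤ) * z → Walkable y₁ y₂ y₃ → ⊥
  avoids (+ c) = avoids⁺ c
  avoids -[1+ c ] y₁ y₂ y₃ eq w = avoids⁺ c (- y₁) (- y₂) (- y₃) (reflect a h z (+ c) y₁ y₂ y₃ eq)
    (weaken y₁ y₂ y₃ (≤-reflexive (cong +_ (∣-i∣≡∣i∣ y₁)))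
      (≤-reflexive (cong +_ (∣-i∣≡∣i∣ y₂))) (≤-reflexive (cong +_ (∣-i∣≡∣i∣ y₃))) w)

-- Integer vectors, affine forms and Farkas certificates.

infixl 6 _⊕_
infixr 7 _⊙_
infix  9 _∙_

_∙_ : ∀ {n} → Vec ℤ n → Vec ℤ n → ℤ
[]       ∙ []       = 0ℤ
(i ∷ is) ∙ (j ∷ js) = i * j + is ∙ js

_⊕_ : ∀ {n} → Vec ℤ n → Vec ℤ n → Vec ℤ n
_⊕_ = zipWith _+_

_⊙_ : ∀ {n} → ℤ → Vec ℤ n → Vec ℤ n
c ⊙ f = map (c *_) f

⊕-∙ : ∀ {n} (f g ρ : Vec ℤ n) → (f ⊕ g) ∙ ρ ≡ f ∙ ρ + g ∙ ρ
⊕-∙ []      []      []      = refl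
⊕-∙ (i ∷ f) (j ∷ g) (k ∷ ρ) rewrite ⊕-∙ f g ρ =
  solve 5 (λ i j k x y → (i :+ j) :* k :+ (x :+ y) := i :* k :+ x :+ (j :* k :+ y)) refl i j k (f ∙ ρ) (g ∙ ρ)

⊙-∙ : ∀ {n} c (f ρ : Vec ℤ n) → (c ⊙ f) ∙ ρ ≡ c * f ∙ ρ
⊙-∙ c []      []      = sym (*-zeroʳ c)
⊙-∙ c (i ∷ f) (k ∷ ρ) rewrite ⊙-∙ c f ρ =
  solve 4 (λ c i k x → c :* i :* k :+ c :* x := c :* (i :* k :+ x)) refl c i k (f ∙ ρ)

zeros-∙ : ∀ {n} (ρ : Vec ℤ n) → replicate n 0ℤ ∙ ρ ≡ 0ℤ
zeros-∙ []      = refl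
zeros-∙ (k ∷ ρ) rewrite zeros-∙ ρ = refl

unit : ∀ {n} → Fin n → Vec ℤ n
unit zero    = 1ℤ ∷ replicate _ 0ℤ
unit (suc i) = 0ℤ ∷ unit i

unit-∙ : ∀ {n} (i : Fin n) (ρ : Vec ℤ n) → unit i ∙ ρ ≡ lookup ρ i
unit-∙ zero    (k ∷ ρ) rewrite zeros-∙ ρ = trans (+-identityʳ _) (*-identityˡ k)
unit-∙ (suc i) (k ∷ ρ) rewrite unit-∙ i ρ = +-identityˡ _

-- The vector (c₀ , c₁ , …) stands for the affine form c₀ + c₁ x₁ + …, evaluated at ρ = (1 , x₁ , …).
Form : ℕ → Set
Form n = Vec ℤ (suc n)

Holds : ∀ {n} → Vec ℤ n → Form n → Set
Holds ρ f = 0ℤ ≤ᶻ f ∙ (1ℤ ∷ ρ)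

constant : ∀ {n} → ℤ → Form n
constant c = c ∷ replicate _ 0ℤ

constant-∙ : ∀ {n} c (ρ : Vec ℤ n) → constant c ∙ (1ℤ ∷ ρ) ≡ c
constant-∙ c ρ rewrite zeros-∙ ρ = trans (+-identityʳ _) (*-identityʳ c)

-- The decimal digits of the number, lowest first, are the Farkas multipliers of the hypotheses.
combine : ∀ {n} → ℕ → List (Form n) → Form n
combine m []       = replicate _ 0ℤ
combine m (f ∷ fs) = (+ (m ℕ.% 10)) ⊙ f ⊕ combine (m ℕ./ 10) fs

combine-holds : ∀ {n} {ρ : Vec ℤ n} m fs → All (Holds ρ) fs → Holds ρ (combine m fs)
combine-holds {ρ = ρ} m [] [] = ≤-reflexive (sym (zeros-∙ (1ℤ ∷ ρ)))
combine-holds {ρ = ρ} m (f ∷ fs) (h ∷ hs)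
  rewrite ⊕-∙ ((+ (m ℕ.% 10)) ⊙ f) (combine (m ℕ./ 10) fs) (1ℤ ∷ ρ) | ⊙-∙ (+ (m ℕ.% 10)) f (1ℤ ∷ ρ) =
  nonneg (m ℕ.% 10) ⊠ h ⊞ combine-holds (m ℕ./ 10) fs hs

isZero : ∀ {n} → Vec ℤ n → Bool
isZero []          = true
isZero (+ 0 ∷ f)   = isZero f
isZero (_ ∷ f)     = false

isZero-∙ : ∀ {n} (f ρ : Vec ℤ n) → T (isZero f) → f ∙ ρ ≡ 0ℤ
isZero-∙ []        []      _ = refl
isZero-∙ (+ 0 ∷ f) (_ ∷ ρ) z rewrite isZero-∙ f ρ z = refl

absurd : ∀ {n} → Form n → Bool
absurd (-[1+ _ ] ∷ f) = isZero f
absurd (+ _ ∷ f)      = false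

absurd-fails : ∀ {n} {ρ : Vec ℤ n} f → T (absurd f) → Holds ρ f → ⊥
absurd-fails {ρ = ρ} (-[1+ c ] ∷ f) z h rewrite isZero-∙ f ρ z | *-identityʳ -[1+ c ] | +-identityʳ -[1+ c ] with () ← h

refutes : ∀ {n} → ℕ → List (Form n) → Bool
refutes m fs = absurd (combine m fs)

refutes-sound : ∀ {n} {ρ : Vec ℤ n} m fs → T (refutes m fs) → All (Holds ρ) fs → ⊥
refutes-sound m fs t hs = absurd-fails (combine m fs) t (combine-holds m fs hs)

-- Integrality turns the negation of f ≥ 0 into the non-strict inequality -f - 1 ≥ 0, which is again
-- given by an affine form.
complement : ∀ {n} → Form n → Form n
complement f = constant -1ℤ ⊕ (-1ℤ ⊙ f)

complement-∙ : ∀ {n} f (ρ : Vec ℤ n) → complement f ∙ (1ℤ ∷ ρ) ≡ - f ∙ (1ℤ ∷ ρ) - 1ℤ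
complement-∙ f ρ rewrite ⊕-∙ (constant -1ℤ) (-1ℤ ⊙ f) (1ℤ ∷ ρ) | constant-∙ -1ℤ ρ | ⊙-∙ -1ℤ f (1ℤ ∷ ρ) =
  solve 1 (λ x → con -1ℤ :+ con -1ℤ :* x := :- x :- con 1ℤ) refl (f ∙ (1ℤ ∷ ρ))

sign : ∀ i → 0ℤ ≤ᶻ i ⊎ 0ℤ ≤ᶻ - i - 1ℤ
sign (+ n)    = inj₁ (nonneg n)
sign -[1+ n ] = inj₂ (nonneg n)

decide : ∀ {n} (ρ : Vec ℤ n) f → Holds ρ f ⊎ Holds ρ (complement f)
decide ρ f rewrite complement-∙ f ρ = sign (f ∙ (1ℤ ∷ ρ))

-- Certified upper bounds for norms.

norm : ∀ {n} → Vec ℤ n → ℕ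
norm []       = 0
norm (i ∷ is) = ∣ i ∣ ℕ.+ norm is

values : ∀ {n m} → Vec ℤ n → Vec (Form n) m → Vec ℤ m
values ρ = map (_∙ (1ℤ ∷ ρ))

-- Certificates that acc + Σ ∣fᵢ∣ is negative; a number in pos or neg certifies that the hypotheses fix the sign of fᵢ.
data Bound : ℕ → Set where
  [_]     : ℕ → Bound 0
  pos neg : ∀ {m} → ℕ → Bound m → Bound (suc m)
  both    : ∀ {m} → Bound m → Bound m → Bound (suc m)

-- The ∣fᵢ∣ are replaced one by one by fᵢ or -fᵢ and added to `acc`, until `acc` alone is refuted.
-- `both` adds no sign to the hypotheses: since one of the two signs is right, it suffices that both
-- sums are refuted.
bounds : ∀ {n m} → Bound m → Form n → Vec (Form n) m → List (Form n) → Bool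
bounds [ c ]      acc []       hs = refutes c (acc ∷ hs)
bounds (pos c b)  acc (f ∷ fs) hs = refutes c (complement f ∷ hs) ∧ bounds b (acc ⊕ f) fs hs
bounds (neg c b)  acc (f ∷ fs) hs = refutes c (complement (-1ℤ ⊙ f) ∷ hs) ∧ bounds b (acc ⊕ -1ℤ ⊙ f) fs hs
bounds (both b c) acc (f ∷ fs) hs = bounds b (acc ⊕ f) fs hs ∧ bounds c (acc ⊕ -1ℤ ⊙ f) fs hs

module _ {n} {ρ : Vec ℤ n} where

  ∣_∣-pos : ∀ f (acc : Form n) r → Holds ρ f →
    0ℤ ≤ᶻ acc ∙ (1ℤ ∷ ρ) + + (∣ f ∙ (1ℤ ∷ ρ) ∣ ℕ.+ r) → 0ℤ ≤ᶻ (acc ⊕ f) ∙ (1ℤ ∷ ρ) + + r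
  ∣ f ∣-pos acc r h p rewrite ⊕-∙ acc f (1ℤ ∷ ρ) =
    subst (0ℤ ≤ᶻ_) (sym (+-assoc (acc ∙ (1ℤ ∷ ρ)) (f ∙ (1ℤ ∷ ρ)) (+ r)))
      (subst (λ i → 0ℤ ≤ᶻ acc ∙ (1ℤ ∷ ρ) + (i + + r)) (0≤i⇒+∣i∣≡i h) p)

  ∣_∣-neg : ∀ f (acc : Form n) r → Holds ρ (-1ℤ ⊙ f) →
    0ℤ ≤ᶻ acc ∙ (1ℤ ∷ ρ) + + (∣ f ∙ (1ℤ ∷ ρ) ∣ ℕ.+ r) → 0ℤ ≤ᶻ (acc ⊕ -1ℤ ⊙ f) ∙ (1ℤ ∷ ρ) + + r
  ∣ f ∣-neg acc r h p = ∣ -1ℤ ⊙ f ∣-pos acc r h (subst (λ k → 0ℤ ≤ᶻ acc ∙ (1ℤ ∷ ρ) + + (k ℕ.+ r)) (sym eq) p)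
    where
    eq : ∣ (-1ℤ ⊙ f) ∙ (1ℤ ∷ ρ) ∣ ≡ ∣ f ∙ (1ℤ ∷ ρ) ∣
    eq = trans (cong ∣_∣ (trans (⊙-∙ -1ℤ f (1ℤ ∷ ρ)) (-1*i≡-i _))) (∣-i∣≡∣i∣ (f ∙ (1ℤ ∷ ρ)))

  complement-weaken : ∀ f → Holds ρ (complement f) → Holds ρ (-1ℤ ⊙ f)
  complement-weaken f h = subst (0ℤ ≤ᶻ_)
    (trans (solve 1 (λ x → :- x :- con 1ℤ :+ con 1ℤ := con -1ℤ :* x) refl (f ∙ (1ℤ ∷ ρ))) (sym (⊙-∙ -1ℤ f (1ℤ ∷ ρ))))
    (subst (0ℤ ≤ᶻ_) (complement-∙ f ρ) h ⊞ nonneg 1)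

  bounds-sound : ∀ {m} (b : Bound m) acc fs {hs} → T (bounds b acc fs hs) → All (Holds ρ) hs →
    0ℤ ≤ᶻ acc ∙ (1ℤ ∷ ρ) + + norm (values ρ fs) → ⊥
  bounds-sound [ c ] acc [] t hs p = refutes-sound c (acc ∷ _) t (subst (0ℤ ≤ᶻ_) (+-identityʳ _) p ∷ hs)
  bounds-sound (pos c b) acc (f ∷ fs) t hs p with Equivalence.to T-∧ t
  ... | t₁ , t₂ = [ (λ h → bounds-sound b (acc ⊕ f) fs t₂ hs (∣ f ∣-pos acc _ h p))
                  , (λ h → refutes-sound c (complement f ∷ _) t₁ (h ∷ hs)) ]′ (decide ρ f)
  bounds-sound (neg c b) acc (f ∷ fs) t hs p with Equivalence.to T-∧ t
  ... | t₁ , t₂ = [ (λ h → bounds-sound b (acc ⊕ -1ℤ ⊙ f) fs t₂ hs (∣ f ∣-neg acc _ h p))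
                  , (λ h → ⊥-elim (refutes-sound c (complement (-1ℤ ⊙ f) ∷ _) t₁ (h ∷ hs))) ]′ (decide ρ (-1ℤ ⊙ f))
  bounds-sound (both b c) acc (f ∷ fs) t hs p with Equivalence.to T-∧ t
  ... | t₁ , t₂ = [ (λ h → bounds-sound b (acc ⊕ f) fs t₁ hs (∣ f ∣-pos acc _ h p))
                  , (λ h → bounds-sound c (acc ⊕ -1ℤ ⊙ f) fs t₂ hs (∣ f ∣-neg acc _ (complement-weaken f h) p)) ]′ (decide ρ f)

-- Affine dependence on a, and decision trees.

-- (α , β) stands for the function α a + β of the parameter a.
Affine : Set
Affine = ℤ × ℤ

infix 9 _⟨_⟩
_⟨_⟩ : Affine → ℤ → ℤ
(α , β) ⟨ a ⟩ = α * a + β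

affine : ∀ {d} → Affine → Form (suc d)
affine (α , β) = β ∷ α ∷ replicate _ 0ℤ

affine-∙ : ∀ {d} p a (y : Vec ℤ d) → affine p ∙ (1ℤ ∷ a ∷ y) ≡ p ⟨ a ⟩
affine-∙ (α , β) a y rewrite zeros-∙ y =
  solve 3 (λ α β a → β :* con 1ℤ :+ (α :* a :+ con 0ℤ) := α :* a :+ β) refl α β a

coordinate : ∀ {n} → Fin n → Form n
coordinate i = unit (suc i)

coordinates : ∀ {d} → Vec (Form (suc d)) d
coordinates = tabulate (coordinate ∘ suc)

coordinates-values : ∀ {d} a (y : Vec ℤ d) → values (a ∷ y) coordinates ≡ y
coordinates-values a y =
  trans (sym (tabulate-∘ (_∙ (1ℤ ∷ a ∷ y)) (coordinate ∘ suc)))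
    (trans (tabulate-cong (λ i → unit-∙ (suc (suc i)) (1ℤ ∷ a ∷ y))) (tabulate∘lookup y))

translate : ∀ {d m} → ℤ → Vec Affine m → Vec (Form (suc d)) m → Vec (Form (suc d)) m
translate c = zipWith (λ p f → f ⊕ - c ⊙ affine p)

translates : ∀ {d m r} → Vec ℤ r → Vec (Vec Affine m) r → Vec (Form (suc d)) m → Vec (Form (suc d)) m
translates []       []       fs = fs
translates (c ∷ cs) (p ∷ ps) fs = translate c p (translates cs ps fs)

translate-∙ : ∀ {d m} a (y : Vec ℤ d) c (ps : Vec Affine m) fs g →
  values (a ∷ y) (translate c ps fs) ∙ g ≡ values (a ∷ y) fs ∙ g + - c * map _⟨ a ⟩ ps ∙ g
translate-∙ a y c []       []       []      = sym (trans (+-identityˡ (- c * 0ℤ)) (*-zeroʳ (- c)))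
translate-∙ a y c (p ∷ ps) (f ∷ fs) (k ∷ g)
  rewrite translate-∙ a y c ps fs g | ⊕-∙ f (- c ⊙ affine p) (1ℤ ∷ a ∷ y) | ⊙-∙ (- c) (affine p) (1ℤ ∷ a ∷ y) | affine-∙ p a y =
  solve 6 (λ c k p f u v → (f :+ :- c :* p) :* k :+ (u :+ :- c :* v) := f :* k :+ u :+ :- c :* (p :* k :+ v))
    refl c k (p ⟨ a ⟩) (f ∙ (1ℤ ∷ a ∷ y)) (values (a ∷ y) fs ∙ g) (map _⟨ a ⟩ ps ∙ g)

-- Each subtracted vector pairs with g to a multiple of n, so the vector obtained represents the
-- same vertex.
translates-∙ : ∀ {d m r n} a (y : Vec ℤ d) cs (ps : Vec (Vec Affine m) r) fs g →
  V.All (λ p → n ∣ map _⟨ a ⟩ p ∙ g) ps → n ∣ values (a ∷ y) (translates cs ps fs) ∙ g - values (a ∷ y) fs ∙ g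
translates-∙ a y []       []       fs g V.[]     = subst (_ ∣_) (sym (+-inverseʳ (values (a ∷ y) fs ∙ g))) (∣n⇒∣m*n 0ℤ ∣-refl)
translates-∙ a y (c ∷ cs) (p ∷ ps) fs g (h V.∷ hs) rewrite translate-∙ a y c p (translates cs ps fs) g =
  subst (_ ∣_) (solve 3 (λ x y z → x :- y :+ z := x :+ z :- y) refl
      (values (a ∷ y) (translates cs ps fs) ∙ g) (values (a ∷ y) fs ∙ g) (- c * map _⟨ a ⟩ p ∙ g))
    (∣m∣n⇒∣m+n (translates-∙ a y cs ps fs g hs) (∣n⇒∣m*n (- c) h))

-- Variable 0 is the parameter a, the others are the coordinates of e. `split` compares a variable
-- with αa + β, the branch for smaller values coming first; `contra` certifies that the region is
-- empty; `use` subtracts a combination of the relations and bounds the norm of the result.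
data Tree (d r : ℕ) : Set where
  split  : Fin (suc d) → Affine → Tree d r → Tree d r → Tree d r
  contra : ℕ → Tree d r
  use    : Vec ℤ r → Bound d → Tree d r

module _ {d r} (radius : Affine) (basis : Vec (Vec Affine d) r) where

  threshold : Fin (suc d) → Affine → Form (suc d)
  threshold i p = coordinate i ⊕ -1ℤ ⊙ affine p

  check : Tree d r → List (Form (suc d)) → Bool
  check (split i p s t) hs = check s (complement (threshold i p) ∷ hs) ∧ check t (threshold i p ∷ hs)
  check (contra c)      hs = refutes c hs
  check (use cs b)      hs = bounds b (complement (affine radius)) (translates cs basis coordinates) hs

  check-sound : ∀ {k a y} → radius ⟨ a ⟩ ≡ + k → ∀ t hs → T (check t hs) → All (Holds (a ∷ y)) hs →
    ∃[ cs ] norm (values (a ∷ y) (translates cs basis coordinates)) ≤ k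
  check-sound {a = a} {y} eq (split i p s t) hs c h with Equivalence.to T-∧ c
  ... | c₁ , c₂ = [ (λ x → check-sound eq t (threshold i p ∷ hs) c₂ (x ∷ h))
                  , (λ x → check-sound eq s (complement (threshold i p) ∷ hs) c₁ (x ∷ h)) ]′
    (decide (a ∷ y) (threshold i p))
  check-sound eq (contra c) hs t h = ⊥-elim (refutes-sound c hs t h)
  -- If the norm exceeded k, then -k - 1 plus the norm would be non-negative; this is what the
  -- certificate `b` refutes.
  check-sound {k} {a} {y} eq (use cs b) hs t h = cs , ℕ.≮⇒≥ λ k<norm →
    bounds-sound b (complement (affine radius)) (translates cs basis coordinates) t h
    (subst (λ i → 0ℤ ≤ᶻ i + + norm v) (sym acc) (subst (0ℤ ≤ᶻ_)
      (solve 2 (λ k m → m :- (con 1ℤ :+ k) := :- k :- con 1ℤ :+ m) refl (+ k) (+ norm v)) (i≤j⇒0≤j-i (+≤+ k<norm))))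
    where
    v : Vec ℤ d
    v = values (a ∷ y) (translates cs basis coordinates)
    acc : complement (affine radius) ∙ (1ℤ ∷ a ∷ y) ≡ - + k - 1ℤ
    acc = trans (complement-∙ (affine radius) (a ∷ y)) (cong (λ i → - i - 1ℤ) (trans (affine-∙ radius a y) eq))

-- The facets of the sphere of radius k + 1 with e₁ ≥ 1.

signed positive : ∀ {n} → Bool → Form n → Form n
signed true    f = f
signed false   f = -1ℤ ⊙ f
positive true  f = f
-- Zero counts as positive, so the other sign is strict.
positive false f = complement f

sign-of : ∀ {n} (ρ : Vec ℤ n) f → ∃[ s ] (signed s f ∙ (1ℤ ∷ ρ) ≡ + ∣ f ∙ (1ℤ ∷ ρ) ∣ × Holds ρ (positive s f))
sign-of ρ f with f ∙ (1ℤ ∷ ρ) in eq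
... | + m      = true , eq , subst (0ℤ ≤ᶻ_) (sym eq) (nonneg m)
... | -[1+ m ] = false , trans (⊙-∙ -1ℤ f (1ℤ ∷ ρ)) (trans (cong (-1ℤ *_) eq) (-1*i≡-i -[1+ m ])) ,
  subst (0ℤ ≤ᶻ_) (sym (trans (complement-∙ f ρ) (cong (λ i → - i - 1ℤ) eq))) (nonneg m)

module _ (radius : Affine) (a₀ : ℤ) where

  private
    y₁ y₂ y₃ y₄ radius⁺ : Form 5
    y₁ = coordinate (suc zero)
    y₂ = coordinate (suc (suc zero))
    y₃ = coordinate (suc (suc (suc zero)))
    y₄ = coordinate (suc (suc (suc (suc zero))))
    radius⁺ = affine radius ⊕ constant 1ℤ

  total : Bool → Bool → Bool → Form 5
  total s₂ s₃ s₄ = y₁ ⊕ (signed s₂ y₂ ⊕ (signed s₃ y₃ ⊕ signed s₄ y₄))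

  -- The facts from which every tree starts: norm k + 1, as two inequalities, then e₁ ≥ 1, the signs
  -- of e₂, e₃, e₄, and a ≥ a₀. Their order matters, as certificates refer to hypotheses by
  -- position; the splits add further ones in front.
  facet : Bool → Bool → Bool → List (Form 5)
  facet s₂ s₃ s₄ =
      radius⁺ ⊕ -1ℤ ⊙ total s₂ s₃ s₄
    ∷ total s₂ s₃ s₄ ⊕ -1ℤ ⊙ radius⁺
    ∷ y₁ ⊕ constant -1ℤ
    ∷ positive s₂ y₂ ∷ positive s₃ y₃ ∷ positive s₄ y₄
    ∷ coordinate zero ⊕ constant (- a₀)
    ∷ []

  facet-holds : ∀ {a k} → radius ⟨ a ⟩ ≡ + k → a₀ ≤ᶻ a → ∀ m v₂ v₃ v₄ → norm (+[1+ m ] ∷ v₂ ∷ v₃ ∷ v₄ ∷ []) ≡ suc k →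
    ∃[ s₂ ] ∃[ s₃ ] ∃[ s₄ ] All (Holds (a ∷ +[1+ m ] ∷ v₂ ∷ v₃ ∷ v₄ ∷ [])) (facet s₂ s₃ s₄)
  facet-holds {a} {k} eq a₀≤a m v₂ v₃ v₄ n
    with sign-of (a ∷ +[1+ m ] ∷ v₂ ∷ v₃ ∷ v₄ ∷ []) y₂
       | sign-of (a ∷ +[1+ m ] ∷ v₂ ∷ v₃ ∷ v₄ ∷ []) y₃
       | sign-of (a ∷ +[1+ m ] ∷ v₂ ∷ v₃ ∷ v₄ ∷ []) y₄
  ... | s₂ , e₂ , p₂ | s₃ , e₃ , p₃ | s₄ , e₄ , p₄ = s₂ , s₃ , s₄ ,
      difference radius⁺ (total s₂ s₃ s₄) (trans radius-value (sym total-value))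
    ∷ difference (total s₂ s₃ s₄) radius⁺ (trans total-value (sym radius-value))
    ∷ subst (0ℤ ≤ᶻ_) (sym (trans (⊕-∙ y₁ (constant -1ℤ) (1ℤ ∷ ρ))
        (cong₂ _+_ (unit-∙ (suc (suc zero)) (1ℤ ∷ ρ)) (constant-∙ -1ℤ ρ)))) (nonneg m)
    ∷ p₂ ∷ p₃ ∷ p₄
    ∷ subst (0ℤ ≤ᶻ_) (sym (trans (⊕-∙ (coordinate zero) (constant (- a₀)) (1ℤ ∷ ρ))
        (cong₂ _+_ (unit-∙ (suc zero) (1ℤ ∷ ρ)) (constant-∙ (- a₀) ρ)))) (i≤j⇒0≤j-i a₀≤a)
    ∷ []
    where
    y : Vec ℤ 4
    y = +[1+ m ] ∷ v₂ ∷ v₃ ∷ v₄ ∷ []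

    ρ : Vec ℤ 5
    ρ = a ∷ y

    tail₃ tail₂ : Form 5
    tail₃ = signed s₃ y₃ ⊕ signed s₄ y₄
    tail₂ = signed s₂ y₂ ⊕ tail₃

    absolute : ∀ {s f v} i → lookup (1ℤ ∷ ρ) (suc i) ≡ v → f ≡ coordinate i →
      signed s f ∙ (1ℤ ∷ ρ) ≡ + ∣ f ∙ (1ℤ ∷ ρ) ∣ → signed s f ∙ (1ℤ ∷ ρ) ≡ + ∣ v ∣
    absolute i refl refl e = trans e (cong (λ v → + ∣ v ∣) (unit-∙ (suc i) (1ℤ ∷ ρ)))

    radius-value : radius⁺ ∙ (1ℤ ∷ ρ) ≡ + suc k
    radius-value = trans (⊕-∙ (affine radius) (constant 1ℤ) (1ℤ ∷ ρ))
      (trans (cong₂ _+_ (trans (affine-∙ radius a y) eq) (constant-∙ 1ℤ ρ)) (+-comm (+ k) 1ℤ))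

    total-value : total s₂ s₃ s₄ ∙ (1ℤ ∷ ρ) ≡ + suc k
    total-value = trans (⊕-∙ y₁ tail₂ (1ℤ ∷ ρ)) (trans (cong₂ _+_ (unit-∙ (suc (suc zero)) (1ℤ ∷ ρ))
      (trans (⊕-∙ (signed s₂ y₂) tail₃ (1ℤ ∷ ρ)) (cong₂ _+_ (absolute {s₂} (suc (suc zero)) refl refl e₂)
      (trans (⊕-∙ (signed s₃ y₃) (signed s₄ y₄) (1ℤ ∷ ρ)) (cong₂ _+_ (absolute {s₃} (suc (suc (suc zero))) refl refl e₃)
        (absolute {s₄} (suc (suc (suc (suc zero)))) refl refl e₄))))))
      (trans (cong (λ j → + (suc m ℕ.+ (∣ v₂ ∣ ℕ.+ (∣ v₃ ∣ ℕ.+ j)))) (sym (ℕ.+-identityʳ ∣ v₄ ∣))) (cong +_ n)))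

    difference : ∀ f g → f ∙ (1ℤ ∷ ρ) ≡ g ∙ (1ℤ ∷ ρ) → Holds ρ (f ⊕ -1ℤ ⊙ g)
    difference f g e = ≤-reflexive (sym (trans (⊕-∙ f (-1ℤ ⊙ g) (1ℤ ∷ ρ))
      (trans (cong₂ _+_ e (trans (⊙-∙ -1ℤ g (1ℤ ∷ ρ)) (-1*i≡-i _))) (+-inverseʳ (g ∙ (1ℤ ∷ ρ))))))

-- Covering of the residues by vectors of norm at most k.

module Covering (radius : Affine) (a₀ : ℤ) {r} (basis : Vec (Vec Affine 4) r) (tree : Bool → Bool → Bool → Tree 4 r)
  (checked : ∀ s₂ s₃ s₄ → T (check radius basis (tree s₂ s₃ s₄) (facet radius a₀ s₂ s₃ s₄)))
  {a : ℤ} {k : ℕ} (radius-a : radius ⟨ a ⟩ ≡ + k) (a₀≤a : a₀ ≤ᶻ a)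
  {n : ℤ} (g : Vec ℤ 3) (periods : V.All (λ p → n ∣ map _⟨ a ⟩ p ∙ (1ℤ ∷ g)) basis) where

  Reachable : ℤ → Set
  Reachable t = ∃[ y ] (norm y ≤ k × n ∣ t - y ∙ (1ℤ ∷ g))

  origin : Reachable 0ℤ
  origin = replicate 4 0ℤ , z≤n , subst (n ∣_) (cong (λ i → 0ℤ - i) (sym (zeros-∙ (1ℤ ∷ g)))) (∣n⇒∣m*n {n} 0ℤ ∣-refl)

  first : ∀ t i u → t - (i * 1ℤ + u) ≡ t + 1ℤ - ((1ℤ + i) * 1ℤ + u)
  first = solve 3 (λ t i u → t :- (i :* con 1ℤ :+ u) := t :+ con 1ℤ :- ((con 1ℤ :+ i) :* con 1ℤ :+ u)) refl

  advance : ∀ t → Reachable t → Reachable (t + 1ℤ)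
  -- A negative first coordinate moves towards 0, so the norm drops.
  advance t (-[1+ m ] ∷ y , s≤ , h) = - + m ∷ y ,
    ℕ.≤-trans (ℕ.≤-trans (ℕ.≤-reflexive (cong (ℕ._+ norm y) (∣-i∣≡∣i∣ (+ m)))) (ℕ.n≤1+n _)) s≤ ,
    subst (n ∣_) (trans (first t -[1+ m ] (y ∙ g)) (cong (λ i → t + 1ℤ - (i * 1ℤ + y ∙ g)) (lem m))) h
    where
    lem : ∀ m → 1ℤ + -[1+ m ] ≡ - + m
    lem zero    = refl
    lem (suc m) = refl
  -- Otherwise the norm grows by 1: either it is still at most k, or it is exactly k + 1 and a tree
  -- supplies the relation to subtract.
  advance t (+ m ∷ y@(y₂ ∷ y₃ ∷ y₄ ∷ []) , s≤ , h) = [ (λ lt → y⁺ , ℕ.s≤s⁻¹ lt , h⁺) , descend ]′ (ℕ.m≤n⇒m<n∨m≡n (ℕ.s≤s s≤))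
    where
    y⁺ : Vec ℤ 4
    y⁺ = +[1+ m ] ∷ y
    h⁺ : n ∣ t + 1ℤ - y⁺ ∙ (1ℤ ∷ g)
    h⁺ = subst (n ∣_) (first t (+ m) (y ∙ g)) h
    descend : norm y⁺ ≡ suc k → Reachable (t + 1ℤ)
    descend eq with facet-holds radius a₀ radius-a a₀≤a m y₂ y₃ y₄ eq
    ... | s₂ , s₃ , s₄ , hs with check-sound radius basis radius-a (tree s₂ s₃ s₄) _ (checked s₂ s₃ s₄) hs
    ... | cs , small = v , small ,
      subst (n ∣_) (trans (cong (λ w → t + 1ℤ - y⁺ ∙ (1ℤ ∷ g) - (v ∙ (1ℤ ∷ g) - w ∙ (1ℤ ∷ g))) (coordinates-values a y⁺))
          (solve 3 (λ t x z → t :- x :- (z :- x) := t :- z) refl (t + 1ℤ) (y⁺ ∙ (1ℤ ∷ g)) (v ∙ (1ℤ ∷ g))))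
        (∣m∣n⇒∣m-n h⁺ (translates-∙ a y⁺ cs basis coordinates (1ℤ ∷ g) periods))
      where
      v : Vec ℤ 4
      v = values (a ∷ y⁺) (translates cs basis coordinates)

  reachable : ∀ t → Reachable (+ t)
  reachable zero    = origin
  reachable (suc t) = subst Reachable (+-comm (+ t) 1ℤ) (advance (+ t) (reachable t))

-- Congruences and walks.

infix 4 _≡_⟨mod_⟩
_≡_⟨mod_⟩ : ℤ → ℤ → ℤ → Set
i ≡ j ⟨mod n ⟩ = n ∣ i - j

mod-reflexive : ∀ {n i j} → i ≡ j → i ≡ j ⟨mod n ⟩
mod-reflexive {n} {i} refl = divides 0ℤ (solve 2 (λ n i → i :- i := con 0ℤ :* n) refl n i)

mod-sym : ∀ {n i j} → i ≡ j ⟨mod n ⟩ → j ≡ i ⟨mod n ⟩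
mod-sym {n} {i} {j} p = subst (n ∣_) (solve 2 (λ i j → :- (i :- j) := j :- i) refl i j) (∣m⇒∣-m p)

from-≡[mod] : ∀ {n a b} → a ≡[mod n ] b → + a ≡ + b ⟨mod + n ⟩
from-≡[mod] {n} {a} {b} (c , d , eq) = divides (+ d - + c) (trans
  (solve 4 (λ a b u v → a :- b := a :+ u :- (b :+ v) :+ (v :- u)) refl (+ a) (+ b) (+ c * + n) (+ d * + n))
  (trans (cong (λ i → i - (+ b + + d * + n) + (+ d * + n - + c * + n)) eqℤ)
    (solve 4 (λ b c d n → b :+ d :* n :- (b :+ d :* n) :+ (d :* n :- c :* n) := (d :- c) :* n) refl (+ b) (+ c) (+ d) (+ n))))
  where
  eqℤ : + a + + c * + n ≡ + b + + d * + n
  eqℤ = trans (cong (λ i → + a + i) (sym (pos-* c n))) (trans (cong +_ eq) (cong (λ i → + b + i) (pos-* d n)))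

-- The witnesses are natural numbers, so the sign of the quotient decides on which side the multiple
-- of n is added.
to-≡[mod] : ∀ {n a b} → + a ≡ + b ⟨mod + n ⟩ → a ≡[mod n ] b
to-≡[mod] {n} {a} {b} (divides (+ q) eq) = 0 , q , +-injective (trans
  (solve 2 (λ a b → a :+ con 0ℤ := a :- b :+ b) refl (+ a) (+ b))
  (trans (cong (_+ + b) (trans eq (sym (pos-* q n)))) (solve 2 (λ x b → x :+ b := b :+ x) refl (+ (q ℕ.* n)) (+ b))))
to-≡[mod] {n} {a} {b} (divides -[1+ q ] eq) = suc q , 0 , +-injective (trans
  (cong (λ i → + a + i) (pos-* (suc q) n))
  (trans (solve 4 (λ a b q n → a :+ q :* n := a :- b :+ (q :* n :+ b)) refl (+ a) (+ b) +[1+ q ] (+ n))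
  (trans (cong (_+ (+[1+ q ] * + n + + b)) eq)
    (solve 3 (λ b q n → :- q :* n :+ (q :* n :+ b) := b :+ con 0ℤ) refl (+ b) +[1+ q ] (+ n)))))

mod-unique : ∀ {n} (x y : Fin n) → + toℕ x ≡ + toℕ y ⟨mod + n ⟩ → x ≡ y
mod-unique {n@(suc _)} x y p with to-≡[mod] {n} {toℕ x} {toℕ y} p
... | c , d , eq = toℕ-injective (trans (sym (m<n⇒m%n≡m (toℕ<n x))) (trans (sym ([m+kn]%n≡m%n (toℕ x) c n))
  (trans (cong (ℕ._% n) eq) (trans ([m+kn]%n≡m%n (toℕ y) d n) (m<n⇒m%n≡m (toℕ<n y))))))

module _ {n : ℕ} .{{_ : NonZero n}} where

  vertex : ℤ → Fin n
  vertex i = fromℕ< (n%ℕd<d i n)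

  vertex-≡ : ∀ i → + toℕ (vertex i) ≡ i ⟨mod + n ⟩
  vertex-≡ i = mod-sym {+ n} {i} {+ toℕ (vertex i)} (divides (i /ℕ n) (trans (cong (_- + toℕ (vertex i)) (a≡a%ℕn+[a/ℕn]*n i n))
    (trans (cong (λ r → + (i %ℕ n) + (i /ℕ n) * + n - + r) (toℕ-fromℕ< (n%ℕd<d i n)))
      (solve 2 (λ r q → r :+ q :- r := q) refl (+ (i %ℕ n)) ((i /ℕ n) * + n)))))

  module _ {gs : Vec ℕ 4} where

    edge⁺ : ∀ {x y g} → g ∈ gs → + toℕ y ≡ + toℕ x + + g ⟨mod + n ⟩ → Adj n gs x y
    edge⁺ {x} {y} {g} g∈ p = g , g∈ , inj₁ (to-≡[mod] (mod-sym {+ n} {+ toℕ y} {+ toℕ x + + g} p))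

    edge⁻ : ∀ {x y g} → g ∈ gs → + toℕ y ≡ + toℕ x - + g ⟨mod + n ⟩ → Adj n gs x y
    edge⁻ {x} {y} {g} g∈ p = g , g∈ , inj₂ (to-≡[mod] (subst (+ n ∣_)
      (solve 3 (λ x y g → y :- (x :- g) := y :+ g :- x) refl (+ toℕ x) (+ toℕ y) (+ g)) p))

    _++_ : ∀ {l m x y z} → Walk n gs l x y → Walk n gs m y z → Walk n gs (l ℕ.+ m) x z
    nil      ++ w = w
    step a v ++ w = step a (v ++ w)

    along⁺ : ∀ {g} → g ∈ gs → ∀ m x y → + toℕ y ≡ + toℕ x + + m * + g ⟨mod + n ⟩ → Walk n gs m x y
    along⁺ {g} g∈ zero x y p with refl ← mod-unique x y (mod-sym {+ n} {+ toℕ y} {+ toℕ x} (subst (λ i → + n ∣ + toℕ y - i)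
      (solve 2 (λ x g → x :+ con 0ℤ :* g := x) refl (+ toℕ x) (+ g)) p)) = nil
    along⁺ {g} g∈ (suc m) x y p = step (edge⁺ g∈ (vertex-≡ (+ toℕ x + + g))) (along⁺ g∈ m x′ y
      (subst (+ n ∣_) (solve 5 (λ x x′ y m g → y :- (x :+ (con 1ℤ :+ m) :* g) :- (x′ :- (x :+ g)) := y :- (x′ :+ m :* g)) refl
          (+ toℕ x) (+ toℕ x′) (+ toℕ y) (+ m) (+ g))
        (∣m∣n⇒∣m-n p (vertex-≡ (+ toℕ x + + g)))))
      where
      x′ : Fin n
      x′ = vertex (+ toℕ x + + g)

    along⁻ : ∀ {g} → g ∈ gs → ∀ m x y → + toℕ y ≡ + toℕ x - + m * + g ⟨mod + n ⟩ → Walk n gs m x y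
    along⁻ {g} g∈ zero x y p with refl ← mod-unique x y (mod-sym {+ n} {+ toℕ y} {+ toℕ x} (subst (λ i → + n ∣ + toℕ y - i)
      (solve 2 (λ x g → x :- con 0ℤ :* g := x) refl (+ toℕ x) (+ g)) p)) = nil
    along⁻ {g} g∈ (suc m) x y p = step (edge⁻ g∈ (vertex-≡ (+ toℕ x - + g))) (along⁻ g∈ m x′ y
      (subst (+ n ∣_) (solve 5 (λ x x′ y m g → y :- (x :- (con 1ℤ :+ m) :* g) :- (x′ :- (x :- g)) := y :- (x′ :- m :* g)) refl
          (+ toℕ x) (+ toℕ x′) (+ toℕ y) (+ m) (+ g))
        (∣m∣n⇒∣m-n p (vertex-≡ (+ toℕ x - + g)))))
      where
      x′ : Fin n
      x′ = vertex (+ toℕ x - + g)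

    along : ∀ {g} → g ∈ gs → ∀ e x y → + toℕ y ≡ + toℕ x + e * + g ⟨mod + n ⟩ → Walk n gs ∣ e ∣ x y
    along g∈ (+ m) = along⁺ g∈ m
    along {g} g∈ -[1+ m ] x y p = along⁻ g∈ (suc m) x y (subst (λ i → + n ∣ + toℕ y - i)
      (solve 3 (λ x m g → x :+ :- m :* g := x :- m :* g) refl (+ toℕ x) +[1+ m ] (+ g)) p)

    -- The coordinates are used up one after the other, each by ∣e∣ steps along its generator. The
    -- vector `hs` holds the generators still to come, while the edges belong to the full `gs`.
    walk : ∀ {d} (hs : Vec ℕ d) → (∀ {g} → g ∈ hs → g ∈ gs) → ∀ es x y →
      + toℕ y ≡ + toℕ x + es ∙ map +_ hs ⟨mod + n ⟩ → Walk n gs (norm es) x y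
    walk [] _ [] x y p with refl ← mod-unique x y (mod-sym {+ n} {+ toℕ y} {+ toℕ x} (subst (λ i → + n ∣ + toℕ y - i)
      (solve 1 (λ x → x :+ con 0ℤ := x) refl (+ toℕ x)) p)) = nil
    walk (h ∷ hs) ⊆ (e ∷ es) x y p = along (⊆ (here refl)) e x x′ (vertex-≡ (+ toℕ x + e * + h)) ++
      walk hs (λ g∈ → ⊆ (there g∈)) es x′ y (subst (+ n ∣_)
        (solve 5 (λ x x′ y u v → y :- (x :+ (u :+ v)) :- (x′ :- (x :+ u)) := y :- (x′ :+ v)) refl
          (+ toℕ x) (+ toℕ x′) (+ toℕ y) (e * + h) (es ∙ map +_ hs))
        (∣m∣n⇒∣m-n p (vertex-≡ (+ toℕ x + e * + h))))
      where
      x′ : Fin n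
      x′ = vertex (+ toℕ x + e * + h)

-- Norms and images of walks in a quotient.

norm-zeros : ∀ d → norm (replicate d 0ℤ) ≡ 0
norm-zeros zero    = refl
norm-zeros (suc d) = norm-zeros d

norm-⊕ : ∀ {d} (u v : Vec ℤ d) → norm (u ⊕ v) ≤ norm u ℕ.+ norm v
norm-⊕ []      []      = z≤n
norm-⊕ (i ∷ u) (j ∷ v) = ℕ.≤-trans (ℕ.+-mono-≤ (∣i+j∣≤∣i∣+∣j∣ i j) (norm-⊕ u v))
  (ℕ.≤-reflexive (interchange ℕ.+-commutativeSemigroup ∣ i ∣ ∣ j ∣ (norm u) (norm v)))

norm-neg : ∀ {d} (u : Vec ℤ d) → norm (-1ℤ ⊙ u) ≡ norm u
norm-neg []      = refl
norm-neg (i ∷ u) = cong₂ ℕ._+_ (trans (cong ∣_∣ (-1*i≡-i i)) (∣-i∣≡∣i∣ i)) (norm-neg u)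

-- A homomorphism ℤₙ → ℤₘ sending every generator to a combination of hs of norm at most 1 does not lengthen walks.
module _ {n : ℕ} {gs : Vec ℕ 4} {M : ℤ} (M∣n : M ∣ + n) {d} (hs : Vec ℤ d)
  (image : ∀ {g} → g ∈ gs → ∃[ es ] (norm es ≤ 1 × + g ≡ es ∙ hs ⟨mod M ⟩)) where

  edge-displacement : ∀ {x y} → Adj n gs x y → ∃[ es ] (norm es ≤ 1 × + toℕ y - + toℕ x ≡ es ∙ hs ⟨mod M ⟩)
  edge-displacement {x} {y} (g , g∈ , inj₁ p) with image g∈
  ... | es , s , q = es , s , subst (M ∣_)
    (solve 4 (λ x y g e → g :- e :- (x :+ g :- y) := y :- x :- e) refl (+ toℕ x) (+ toℕ y) (+ g) (es ∙ hs))
    (∣m∣n⇒∣m-n q (∣-trans M∣n (from-≡[mod] p)))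
  -- Here the edge displaces by -g, hence the negated combination, which has the same norm.
  edge-displacement {x} {y} (g , g∈ , inj₂ p) with image g∈
  ... | es , s , q = -1ℤ ⊙ es , ℕ.≤-trans (ℕ.≤-reflexive (norm-neg es)) s , subst (M ∣_)
    (trans (solve 4 (λ x y g e → y :+ g :- x :- (g :- e) := y :- x :- con -1ℤ :* e) refl (+ toℕ x) (+ toℕ y) (+ g) (es ∙ hs))
      (cong (λ i → + toℕ y - + toℕ x - i) (sym (⊙-∙ -1ℤ es hs))))
    (∣m∣n⇒∣m-n (∣-trans M∣n (from-≡[mod] p)) q)

  displacement : ∀ {m x y} → Walk n gs m x y → ∃[ es ] (norm es ≤ m × + toℕ y - + toℕ x ≡ es ∙ hs ⟨mod M ⟩)
  displacement {x = x} nil = replicate d 0ℤ , ℕ.≤-reflexive (norm-zeros d) ,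
    mod-reflexive {M} (trans (solve 1 (λ x → x :- x := con 0ℤ) refl (+ toℕ x)) (sym (zeros-∙ hs)))
  displacement {x = x} {z} (step {y = y} a w) with edge-displacement a | displacement w
  ... | u , s , p | v , t , q = u ⊕ v , ℕ.≤-trans (norm-⊕ u v) (ℕ.+-mono-≤ s t) , subst (M ∣_)
    (trans (solve 5 (λ x y z u v → y :- x :- u :+ (z :- y :- v) := z :- x :- (u :+ v)) refl (+ toℕ x) (+ toℕ y) (+ toℕ z) (u ∙ hs) (v ∙ hs))
      (cong (λ i → + toℕ z - + toℕ x - i) (sym (⊕-∙ u v hs))))
    (∣m∣n⇒∣m+n p q)

All-∈ : ∀ {A B : Set} {P : B → Set} {f : A → B} {n} {xs : Vec A n} {x} → V.All P (map f xs) → x ∈ xs → P (f x)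
All-∈ {xs = _ ∷ _} (p V.∷ ps) (here refl) = p
All-∈ {xs = _ ∷ _} (p V.∷ ps) (there x∈)  = All-∈ ps x∈

-- Upper and lower bounds for the diameter.

quotient-gens : ℤ → ℤ → Vec ℤ 3
quotient-gens a b = 1ℤ ∷ height a b ∷ height a b + + 2 * a ∷ []

-- Norm at most 1 leaves 0 and ± one of 1, h, h + 2a, so that a step of a walk costs at most one
-- step in the quotient.
Image : ℤ → ℤ → ℤ → Set
Image a b g = ∃[ es ] (norm es ≤ 1 × g ≡ es ∙ quotient-gens a b ⟨mod + 2 * antipode a b ⟩)

-- A combination congruent to z modulo 2z differs from z by an even multiple of z; the index of the
-- resulting odd multiple is -q.
odd-multiple : ∀ a h z q u v w → z - (u ∷ v ∷ w ∷ []) ∙ (1ℤ ∷ h ∷ h + + 2 * a ∷ []) ≡ q * (+ 2 * z) →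
  u + h * v + (h + + 2 * a) * w ≡ (+ 2 * - q + 1ℤ) * z
odd-multiple a h z q u v w eq = trans
  (solve 6 (λ a h z u v w → u :+ h :* v :+ (h :+ con (+ 2) :* a) :* w :=
    z :- (z :- (u :* con 1ℤ :+ (v :* h :+ (w :* (h :+ con (+ 2) :* a) :+ con 0ℤ))))) refl a h z u v w)
  (trans (cong (λ i → z - i) eq) (solve 2 (λ q z → z :- q :* (con (+ 2) :* z) := (con (+ 2) :* :- q :+ con 1ℤ) :* z) refl q z))

-- Converts norm < k into the `Walkable` of `Antipode`; the summand 0 is the norm of the empty
-- vector.
slack : ∀ {a b k} → + k ≡ a + b - 1ℤ → ∀ p q r → + k - + suc (p ℕ.+ (q ℕ.+ (r ℕ.+ 0))) ≡ a + b - + 2 - + p - + q - + r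
slack {a} {b} eq p q r = trans (cong (_- + suc (p ℕ.+ (q ℕ.+ (r ℕ.+ 0)))) eq)
  (solve 5 (λ a b p q r → a :+ b :- con 1ℤ :- (con 1ℤ :+ (p :+ (q :+ (r :+ con 0ℤ)))) := a :+ b :- con (+ 2) :- p :- q :- r) refl a b (+ p) (+ q) (+ r))

module _ {n : ℕ} .{{_ : NonZero n}} {hs : Vec ℕ 3} {k : ℕ} where

  -- By translation it suffices to represent the residue of y - x; the norm of the vector found is
  -- the length of the walk.
  connected-within : ∀ {N G} → + n ≡ N → map +_ hs ≡ G → (∀ t → ∃[ y ] (norm y ≤ k × N ∣ + t - y ∙ (1ℤ ∷ G))) →
    ∀ x y → ∃[ m ] (m ≤ k × Walk n (1 ∷ hs) m x y)
  connected-within refl refl reach x y with reach ((+ toℕ y - + toℕ x) %ℕ n)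
  ... | es , short , p = norm es , short , walk (1 ∷ hs) (λ g∈ → g∈) es x y
    (subst (+ n ∣_) (solve 5 (λ x y r e q → r :- e :+ ((y :- x) :- r) := y :- (x :+ e)) refl
        (+ toℕ x) (+ toℕ y) (+ r) (es ∙ (1ℤ ∷ map +_ hs)) (q * + n))
      (∣m∣n⇒∣m+n p (divides q (trans (cong (_- + r) (a≡a%ℕn+[a/ℕn]*n (+ toℕ y - + toℕ x) n))
        (solve 2 (λ r q → r :+ q :- r := q) refl (+ r) (q * + n))))))
    where
    r : ℕ
    r = (+ toℕ y - + toℕ x) %ℕ n
    q : ℤ
    q = (+ toℕ y - + toℕ x) /ℕ n

  module _ (a b : ℤ) (1≤a : 0ℤ ≤ᶻ a - 1ℤ) (2≤b : 0ℤ ≤ᶻ b - + 2) (a≤b : 0ℤ ≤ᶻ b - a) (radius : + k ≡ a + b - 1ℤ) where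

    open Antipode a b 1≤a 2≤b a≤b using (avoids)

    -- As 2z divides n, a walk of length below k would, read modulo 2z, yield an odd multiple of z
    -- excluded by `avoids`.
    antipode-far : ∀ {N G} → + n ≡ N → map +_ hs ≡ G → N ≡ + 2 * a * (+ 2 * antipode a b) → V.All (Image a b) (1ℤ ∷ G) →
      ∀ m → Walk n (1 ∷ hs) m (vertex 0ℤ) (vertex (antipode a b)) → k ≤ m
    antipode-far refl refl order images m w = bound (displacement M∣n (quotient-gens a b) (All-∈ {f = +_} {xs = 1 ∷ hs} images) w)
      where
      z M : ℤ
      z = antipode a b
      M = + 2 * z

      M∣n : M ∣ + n
      M∣n = divides (+ 2 * a) order

      bound : ∃[ es ] (norm es ≤ m × + toℕ (vertex {n} z) - + toℕ (vertex {n} 0ℤ) ≡ es ∙ quotient-gens a b ⟨mod M ⟩) → k ≤ m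
      bound (es@(u ∷ v ∷ w ∷ []) , s , p) = ℕ.≮⇒≥ λ m<k → conclude (z∣ p) (ℕ.≤-<-trans s m<k)
        where
        e : ℤ
        e = es ∙ quotient-gens a b
        y x : ℤ
        y = + toℕ (vertex {n} z)
        x = + toℕ (vertex {n} 0ℤ)
        z∣ : M ∣ y - x - e → M ∣ z - e
        -- `vertex` returns residues modulo n; since 2z divides n, they may be replaced by z and 0.
        z∣ p = subst (M ∣_) (solve 4 (λ x y z e → y :- x :- e :- (y :- z) :+ (x :- con 0ℤ) := z :- e) refl x y z e)
          (∣m∣n⇒∣m+n (∣m∣n⇒∣m-n p (∣-trans M∣n (vertex-≡ z))) (∣-trans M∣n (vertex-≡ 0ℤ)))
        conclude : M ∣ z - e → norm es ℕ.< k → ⊥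
        conclude (divides q eq) norm<k = avoids (- q) u v w (odd-multiple a (height a b) z q u v w eq)
          (subst (0ℤ ≤ᶻ_) (slack {a} {b} radius (∣ u ∣) (∣ v ∣) (∣ w ∣)) (i≤j⇒0≤j-i (+≤+ norm<k)))

-- Integer casts and ring solver syntax.

polyℤ : List ℕ → ℤ → ℤ
polyℤ []       x = 0ℤ
polyℤ (c ∷ cs) x = + c + x * polyℤ cs x

-- Moves the closed forms to the integers, where the identities in c are proved; some of the
-- quotients there are negative.
poly-cast : ∀ cs x → + poly cs x ≡ polyℤ cs (+ x)
poly-cast []       x = refl
poly-cast (c ∷ cs) x = cong (λ i → + c + i) (trans (pos-* x (poly cs x)) (cong (λ i → + x * i) (poly-cast cs x)))

-- The subscript ₛ marks the ring solver's syntax for the function of the same name.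
polyₛ : ∀ {n} → List ℕ → Polynomial n → Polynomial n
polyₛ []       x = con 0ℤ
polyₛ (c ∷ cs) x = con (+ c) :+ x :* polyₛ cs x

i₀ i₁ i₂ i₃ i₄ : Fin 5
i₀ = zero
i₁ = suc zero
i₂ = suc (suc zero)
i₃ = suc (suc (suc zero))
i₄ = suc (suc (suc (suc zero)))

affineₛ : ∀ {n} → Polynomial n → Affine → Polynomial n
affineₛ a (α , β) = con α :* a :+ con β

_∙ₛ_ : ∀ {n m} → Vec (Polynomial n) m → Vec (Polynomial n) m → Polynomial n
[]       ∙ₛ []       = con 0ℤ
(x ∷ xs) ∙ₛ (y ∷ ys) = x :* y :+ xs ∙ₛ ys

heightₛ antipodeₛ : ∀ {n} → Polynomial n → Polynomial n → Polynomial n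
heightₛ a b = con (+ 2) :* a :* (b :- con 1ℤ) :+ con (+ 2)
antipodeₛ a b = b :* heightₛ a b :+ a :- con 1ℤ

quotient-gensₛ : ∀ {n} → Polynomial n → Polynomial n → Vec (Polynomial n) 3
quotient-gensₛ a b = con 1ℤ ∷ heightₛ a b ∷ heightₛ a b :+ con (+ 2) :* a ∷ []

-- The case of even k.

even-basis : Vec (Vec Affine 4) 4
even-basis =
    ((1ℤ , 0ℤ) ∷ (1ℤ , 0ℤ) ∷ (1ℤ , 0ℤ) ∷ (1ℤ , 1ℤ) ∷ [])
  ∷ ((1ℤ , 0ℤ) ∷ (1ℤ , 0ℤ) ∷ (-1ℤ , 0ℤ) ∷ (-1ℤ , -1ℤ) ∷ [])
  ∷ ((1ℤ , 0ℤ) ∷ (-1ℤ , 0ℤ) ∷ (1ℤ , 1ℤ) ∷ (1ℤ , 0ℤ) ∷ [])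
  ∷ ((1ℤ , 1ℤ) ∷ (1ℤ , -1ℤ) ∷ (-1ℤ , -1ℤ) ∷ (1ℤ , 0ℤ) ∷ [])
  ∷ []

-- The trees were found by computer search.  Their arguments record which of e₂, e₃, e₄ are non-negative.  For k = 2
-- other relations are needed than for larger k, hence the initial split at a = 2.
even-tree : Bool → Bool → Bool → Tree 4 4
even-tree true true true =
  split i₀ (0ℤ , + 2)
  (split i₁ (0ℤ , + 3)
   (split i₂ (0ℤ , 1ℤ)
    (split i₁ (0ℤ , + 2)
     (split i₃ (0ℤ , 1ℤ)
      (use (1ℤ ∷ 0ℤ ∷ 0ℤ ∷ 0ℤ ∷ []) (pos 100100001 (neg 1000000001001 (neg 1000000000011 (pos 1000010001111 [ 22001000001 ])))))
      (use (0ℤ ∷ 0ℤ ∷ 1ℤ ∷ 0ℤ ∷ []) (pos 100100001 (pos 1001000000001 (neg 101101100001 (neg 1101100011 [ 2000010002201 ]))))))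
     (split i₃ (0ℤ , 1ℤ)
      (use (0ℤ ∷ 0ℤ ∷ 0ℤ ∷ 1ℤ ∷ []) (pos 100101 (pos 1000100001 (pos 1010000000001 (pos 1000010011011 [ 2000001000001 ])))))
      (use (0ℤ ∷ 1ℤ ∷ 1ℤ ∷ 0ℤ ∷ []) (pos 200101 (pos 1000000001 (pos 11 (pos 100000000001 [ 101002000111 ])))))))
    (split i₁ (0ℤ , + 2)
     (split i₂ (0ℤ , + 2)
      (use (1ℤ ∷ 0ℤ ∷ 0ℤ ∷ 0ℤ ∷ []) (pos 100100001 (pos 101001 (neg 100101101001 (neg 10101101001 [ 4000010000221 ])))))
      (use (1ℤ ∷ 1ℤ ∷ 0ℤ ∷ 0ℤ ∷ []) (neg 110001000011 (pos 200011 (pos 10000000001 (pos 100000000001 [ 201000001 ]))))))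
     (use (1ℤ ∷ 1ℤ ∷ 0ℤ ∷ 0ℤ ∷ []) (pos 20011 (neg 11000100011 (pos 1000000001 (pos 10000000001 [ 100201 ])))))))
   (use (0ℤ ∷ 1ℤ ∷ 1ℤ ∷ 1ℤ ∷ []) (neg 1111001001 (pos 1000101 (pos 1010000001 (pos 100000101 [ 1221 ]))))))
  (split i₁ (1ℤ , 1ℤ)
   (split i₂ (1ℤ , 1ℤ)
    (split i₃ (1ℤ , 1ℤ)
     (split i₄ (1ℤ , + 2)
      (use (1ℤ ∷ 0ℤ ∷ 0ℤ ∷ 0ℤ ∷ []) (neg 10001 (neg 1001 (neg 101 (neg 11 [ 10000001 ])))))
      (use (0ℤ ∷ -1ℤ ∷ 0ℤ ∷ 1ℤ ∷ []) (pos 100000001 (pos 1000000001 (pos 10000000001 (neg 11101000001 [ 1000021 ]))))))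
     (split i₂ (0ℤ , 1ℤ)
      (split i₃ (1ℤ , + 2)
       (use (0ℤ ∷ 0ℤ ∷ 1ℤ ∷ 0ℤ ∷ []) (neg 100001 (pos 10001000001 (pos 1001 (neg 11010001001 [ 100000221 ])))))
       (split i₁ (1ℤ , -1ℤ)
        (use (1ℤ ∷ 0ℤ ∷ 0ℤ ∷ -1ℤ ∷ []) (pos 10000000001 (neg 1001 (neg 10110100000001 (both ([ 200100000201 ]) ([ 1000000021 ]))))))
        (use (0ℤ ∷ 1ℤ ∷ 1ℤ ∷ -1ℤ ∷ []) (pos 11 (pos 100010000001 (pos 101 (pos 10000010000001 [ 100000001 ])))))))
      (split i₃ (1ℤ , + 2)
       (split i₄ (0ℤ , 1ℤ)
        (use (1ℤ ∷ 1ℤ ∷ 0ℤ ∷ -1ℤ ∷ []) (neg 10000100011001 (neg 100001 (pos 10001 (pos 10000010000001 [ 1000000221 ])))))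
        (use (1ℤ ∷ 0ℤ ∷ 0ℤ ∷ -1ℤ ∷ []) (pos 10000000001 (pos 1001 (neg 10000101 (pos 11 [ 100020001 ]))))))
       (use (1ℤ ∷ 0ℤ ∷ 0ℤ ∷ -1ℤ ∷ []) (pos 1000000001 (pos 101 (neg 1001010000101 (both ([ 10000021 ]) ([ 2000010000021 ])))))))))
    (split i₁ (1ℤ , 0ℤ)
     (split i₂ (1ℤ , + 2)
      (split i₄ (0ℤ , 1ℤ)
       (use (1ℤ ∷ 1ℤ ∷ 0ℤ ∷ -1ℤ ∷ []) (neg 1001 (pos 10001 (neg 1001010010001 (pos 1000001000001 [ 100000221 ])))))
       (use (1ℤ ∷ 0ℤ ∷ -1ℤ ∷ 0ℤ ∷ []) (pos 1000000001 (neg 1000101 (pos 100000000001 (pos 11 [ 10020001 ]))))))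
      (use (1ℤ ∷ 0ℤ ∷ -1ℤ ∷ 0ℤ ∷ []) (pos 100000001 (neg 110101000001 (pos 10000000001 (both ([ 1000021 ]) ([ 200001000021 ])))))))
     (use (1ℤ ∷ 1ℤ ∷ 0ℤ ∷ 0ℤ ∷ []) (neg 11001 (neg 11000110011 (pos 1000000001 (pos 10000000001 [ 100221 ])))))))
   (split i₂ (1ℤ , 0ℤ)
    (split i₁ (1ℤ , + 3)
     (split i₃ (0ℤ , + 2)
      (split i₁ (1ℤ , + 2)
       (split i₃ (0ℤ , 1ℤ)
        (use (0ℤ ∷ 0ℤ ∷ 0ℤ ∷ 1ℤ ∷ []) (pos 1000001 (neg 100001 (pos 1000010000001 (neg 1100101000001 [ 1000000221 ])))))
        (use (0ℤ ∷ 1ℤ ∷ 1ℤ ∷ 0ℤ ∷ []) (neg 10000101 (pos 100000000001 (pos 11 (pos 1000101101 [ 102000001 ]))))))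
       (use (0ℤ ∷ 1ℤ ∷ 1ℤ ∷ 0ℤ ∷ []) (neg 1001001 (pos 10000000001 (neg 101 (pos 1000000000001 [ 200010000021 ]))))))
      (use (0ℤ ∷ 1ℤ ∷ 1ℤ ∷ 0ℤ ∷ []) (neg 100101 (pos 1000000001 (pos 11 (pos 100000000001 [ 1020001 ]))))))
     (use (0ℤ ∷ 1ℤ ∷ 1ℤ ∷ 0ℤ ∷ []) (both (pos 100000001 (both (pos 10000000001 [ 120001 ]) (pos 10000000001 [ 2000120001 ]))) (pos 100000001 (both (pos 10000000001 [ 100021 ]) (pos 10000000001 [ 2000100021 ]))))))
    (use (1ℤ ∷ 1ℤ ∷ 0ℤ ∷ 0ℤ ∷ []) (neg 1100011011 (neg 1100011101 (pos 100000001 (pos 1000000001 [ 10221 ])))))))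
even-tree true true false =
  split i₀ (0ℤ , + 2)
  (split i₁ (0ℤ , + 2)
   (split i₃ (0ℤ , 1ℤ)
    (use (0ℤ ∷ 1ℤ ∷ 0ℤ ∷ 0ℤ ∷ []) (pos 1001001 (neg 1101011001 (pos 10100000001 (pos 111011001 [ 20000100221 ])))))
    (use (0ℤ ∷ 1ℤ ∷ 1ℤ ∷ 0ℤ ∷ []) (neg 1010010011 (pos 10000001 (pos 11 (pos 11012011 [ 2002012001 ]))))))
   (use (0ℤ ∷ 1ℤ ∷ 1ℤ ∷ 0ℤ ∷ []) (pos 211 (pos 1000001 (neg 101001211 (pos 11001211 [ 331002011 ]))))))
  (split i₁ (1ℤ , 0ℤ)
   (split i₄ (-1ℤ , 0ℤ)
    (split i₂ (0ℤ , 1ℤ)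
     (split i₄ (-1ℤ , -1ℤ)
      (split i₁ (1ℤ , -1ℤ)
       (use (0ℤ ∷ 1ℤ ∷ 0ℤ ∷ -1ℤ ∷ []) (pos 1000000001 (neg 1001 (both (pos 111010000001 [ 20010000201 ]) (pos 111010000001 [ 100000021 ])))))
       (use (-1ℤ ∷ 1ℤ ∷ 1ℤ ∷ 0ℤ ∷ []) (neg 100001 (pos 10001000001 (pos 100001000001 (pos 110010000011 [ 10000221 ]))))))
      (use (0ℤ ∷ 1ℤ ∷ 1ℤ ∷ -1ℤ ∷ []) (neg 10001 (pos 1000100001 (neg 1101001001 (pos 11 [ 10000201 ]))))))
     (split i₃ (0ℤ , 1ℤ)
      (split i₄ (-1ℤ , -1ℤ)
       (use (0ℤ ∷ 1ℤ ∷ 0ℤ ∷ -1ℤ ∷ []) (pos 1000000001 (pos 1001 (neg 101 (pos 101010001001 [ 200010000021 ])))))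
       (use (0ℤ ∷ 1ℤ ∷ 0ℤ ∷ 0ℤ ∷ []) (neg 100001 (neg 101010010001 (pos 100001000001 (pos 11 [ 100000201 ]))))))
      (use (0ℤ ∷ 1ℤ ∷ 0ℤ ∷ -1ℤ ∷ []) (pos 100000001 (pos 101 (pos 11 (pos 101000111 [ 1002001 ])))))))
    (split i₃ (1ℤ , + 2)
     (split i₂ (1ℤ , + 2)
      (use (1ℤ ∷ 1ℤ ∷ 0ℤ ∷ -1ℤ ∷ []) (neg 10001 (neg 11 (neg 101 (pos 1001 [ 10000001 ])))))
      (use (1ℤ ∷ 0ℤ ∷ -1ℤ ∷ 0ℤ ∷ []) (pos 100000001 (neg 110101000001 (pos 10000000001 (neg 100000000001 [ 1000021 ]))))))
     (split i₂ (0ℤ , 1ℤ)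
      (split i₃ (1ℤ , + 3)
       (use (0ℤ ∷ 1ℤ ∷ 1ℤ ∷ -1ℤ ∷ []) (neg 100001 (pos 10001000001 (pos 1001 (pos 11010001001 [ 100000221 ])))))
       (use (1ℤ ∷ 0ℤ ∷ 0ℤ ∷ -1ℤ ∷ []) (pos 1000000001 (neg 101 (neg 1011010000001 (neg 1000000000001 [ 20010000021 ]))))))
      (use (1ℤ ∷ 0ℤ ∷ 0ℤ ∷ -1ℤ ∷ []) (pos 100000001 (pos 11 (neg 100101000011 (neg 100000000001 [ 1000201 ]))))))))
   (split i₁ (1ℤ , + 2)
    (split i₃ (0ℤ , + 2)
     (split i₁ (1ℤ , 1ℤ)
      (split i₃ (0ℤ , 1ℤ)
       (use (0ℤ ∷ 1ℤ ∷ 0ℤ ∷ 0ℤ ∷ []) (pos 100001 (neg 1100010100001 (pos 100001000001 (pos 110010100001 [ 100000221 ])))))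
       (use (0ℤ ∷ 1ℤ ∷ 1ℤ ∷ 0ℤ ∷ []) (neg 1000101 (pos 10000000001 (pos 11 (neg 1000000000001 [ 10200001 ]))))))
      (use (0ℤ ∷ 1ℤ ∷ 1ℤ ∷ 0ℤ ∷ []) (neg 101001 (pos 1000000001 (neg 101 (neg 100000000001 [ 20001000021 ]))))))
     (use (0ℤ ∷ 1ℤ ∷ 1ℤ ∷ 0ℤ ∷ []) (neg 10101 (pos 100000001 (pos 11 (neg 10000000001 [ 102001 ]))))))
    (use (0ℤ ∷ 1ℤ ∷ 1ℤ ∷ 0ℤ ∷ []) (neg 1110010001 (pos 10000001 (both (neg 1000000001 [ 10021 ]) (neg 1000000001 [ 200010021 ])))))))
even-tree true false true =
  split i₀ (0ℤ , + 2)
  (split i₂ (0ℤ , 1ℤ)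
   (use (0ℤ ∷ 0ℤ ∷ 0ℤ ∷ 1ℤ ∷ []) (neg 111001101 (pos 1000101 (pos 101101101 (neg 11101101 [ 2000010021 ])))))
   (use (0ℤ ∷ 1ℤ ∷ 0ℤ ∷ 0ℤ ∷ []) (pos 100101 (pos 111 (pos 100101111 (pos 310101012 [ 20001001 ]))))))
  (split i₂ (1ℤ , 0ℤ)
   (split i₁ (1ℤ , + 2)
    (split i₃ (-1ℤ , -1ℤ)
     (use (-1ℤ ∷ 0ℤ ∷ 0ℤ ∷ 1ℤ ∷ []) (pos 10000001 (pos 100000001 (pos 10110100001 (pos 10000000001 [ 100021 ])))))
     (split i₄ (1ℤ , 1ℤ)
      (use (0ℤ ∷ 0ℤ ∷ 0ℤ ∷ 1ℤ ∷ []) (neg 1001 (neg 10001 (pos 101 (neg 11 [ 10000001 ])))))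
      (use (0ℤ ∷ -1ℤ ∷ 0ℤ ∷ 1ℤ ∷ []) (pos 100000001 (pos 1000000001 (neg 10000000001 (neg 11101000001 [ 1000021 ])))))))
    (use (0ℤ ∷ 1ℤ ∷ 1ℤ ∷ 0ℤ ∷ []) (neg 1110010001 (pos 10000001 (neg 100000001 (pos 1000000001 [ 10021 ]))))))
   (split i₂ (1ℤ , 1ℤ)
    (split i₄ (0ℤ , 1ℤ)
     (use (0ℤ ∷ 1ℤ ∷ 0ℤ ∷ 0ℤ ∷ []) (neg 11000101001 (pos 1001 (pos 10010101001 (pos 10000010001 [ 1000221 ])))))
     (use (1ℤ ∷ 0ℤ ∷ -1ℤ ∷ 0ℤ ∷ []) (pos 10000001 (neg 10101 (neg 1000000001 (pos 11 [ 102001 ]))))))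
    (use (1ℤ ∷ 0ℤ ∷ -1ℤ ∷ 0ℤ ∷ []) (pos 1000001 (neg 1101010001 (neg 100000001 (both ([ 10021 ]) ([ 2000010021 ]))))))))
even-tree true false false =
  split i₀ (0ℤ , + 2)
  (use (0ℤ ∷ 1ℤ ∷ 0ℤ ∷ 0ℤ ∷ []) (pos 10011 (neg 11010111 (pos 10110111 (pos 1110111 [ 22200121 ])))))
  (split i₁ (1ℤ , 1ℤ)
   (split i₄ (-1ℤ , -1ℤ)
    (split i₂ (0ℤ , 1ℤ)
     (split i₄ (-1ℤ , -[1+ 1 ])
      (use (0ℤ ∷ 1ℤ ∷ 0ℤ ∷ -1ℤ ∷ []) (pos 100000001 (neg 101 (neg 10000000001 (pos 11101000001 [ 2001000021 ])))))
      (use (-1ℤ ∷ 1ℤ ∷ 1ℤ ∷ 0ℤ ∷ []) (neg 11001001001 (pos 1000100001 (pos 1101001001 (pos 11 [ 10000201 ]))))))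
     (use (0ℤ ∷ 1ℤ ∷ 0ℤ ∷ -1ℤ ∷ []) (pos 10000001 (pos 11 (neg 1000000001 (pos 1010100011 [ 100201 ]))))))
    (split i₃ (-1ℤ , 0ℤ)
     (use (-1ℤ ∷ 0ℤ ∷ 0ℤ ∷ 1ℤ ∷ []) (pos 10000001 (pos 100000001 (pos 10110100001 (neg 10000000001 [ 100021 ])))))
     (split i₂ (1ℤ , 1ℤ)
      (use (0ℤ ∷ 1ℤ ∷ 0ℤ ∷ 0ℤ ∷ []) (neg 10001 (neg 11 (pos 101 (pos 1001 [ 10000001 ])))))
      (use (1ℤ ∷ 0ℤ ∷ -1ℤ ∷ 0ℤ ∷ []) (pos 100000001 (neg 110101000001 (neg 10000000001 (neg 100000000001 [ 1000021 ]))))))))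
   (use (0ℤ ∷ 1ℤ ∷ 1ℤ ∷ 0ℤ ∷ []) (neg 111001001 (pos 1000001 (neg 10000001 (neg 100000001 [ 1021 ]))))))
even-tree false true true =
  split i₀ (0ℤ , + 2)
  (split i₁ (0ℤ , + 2)
   (split i₂ (0ℤ , -1ℤ)
    (use (-1ℤ ∷ 0ℤ ∷ 1ℤ ∷ 1ℤ ∷ []) (neg 10000000101 (pos 1101011001 (pos 10100000001 (pos 1000001001 [ 2012021 ])))))
    (use (0ℤ ∷ 0ℤ ∷ 1ℤ ∷ 0ℤ ∷ []) (pos 1001001 (pos 10000000011 (neg 1011011001 (neg 111011001 [ 20000100201 ]))))))
   (use (-1ℤ ∷ 0ℤ ∷ 1ℤ ∷ 1ℤ ∷ []) (pos 111 (pos 110001111 (pos 131001012 (pos 100000101 [ 2001001 ]))))))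
  (split i₃ (1ℤ , + 2)
   (split i₁ (1ℤ , 1ℤ)
    (split i₂ (-1ℤ , 0ℤ)
     (split i₂ (-1ℤ , -1ℤ)
      (use (-1ℤ ∷ 0ℤ ∷ 1ℤ ∷ 0ℤ ∷ []) (pos 100000001 (pos 110101000001 (both (pos 100000000001 [ 1000021 ]) (pos 100000000001 [ 20001000021 ])))))
      (split i₃ (0ℤ , 1ℤ)
       (use (-1ℤ ∷ 0ℤ ∷ 1ℤ ∷ 1ℤ ∷ []) (neg 10001 (pos 101 (pos 100001000001 (neg 101010001001 [ 100000021 ])))))
       (use (-1ℤ ∷ 0ℤ ∷ 1ℤ ∷ 0ℤ ∷ []) (pos 1000000001 (pos 1000101 (pos 11 (pos 1000000000001 [ 10002001 ])))))))
     (split i₄ (1ℤ , 1ℤ)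
      (use (0ℤ ∷ 0ℤ ∷ 1ℤ ∷ 0ℤ ∷ []) (neg 1001 (pos 101 (neg 10001 (neg 11 [ 10000001 ])))))
      (use (0ℤ ∷ -1ℤ ∷ 0ℤ ∷ 1ℤ ∷ []) (pos 100000001 (neg 1000000001 (pos 10000000001 (neg 11101000001 [ 1000021 ])))))))
    (split i₁ (1ℤ , + 2)
     (split i₃ (0ℤ , 1ℤ)
      (use (-1ℤ ∷ 0ℤ ∷ 1ℤ ∷ 1ℤ ∷ []) (pos 1001 (pos 110001001001 (pos 10000100001 (neg 11001001001 [ 10000221 ])))))
      (use (0ℤ ∷ 1ℤ ∷ 1ℤ ∷ 0ℤ ∷ []) (neg 100101 (neg 1000000001 (pos 11 (pos 100000000001 [ 1002001 ]))))))
     (use (0ℤ ∷ 1ℤ ∷ 1ℤ ∷ 0ℤ ∷ []) (neg 11100100001 (neg 100000001 (both (pos 10000000001 [ 100021 ]) (pos 10000000001 [ 2000100021 ])))))))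
   (split i₃ (1ℤ , + 3)
    (split i₄ (0ℤ , 1ℤ)
     (use (0ℤ ∷ 1ℤ ∷ 1ℤ ∷ -1ℤ ∷ []) (neg 10100101001 (pos 10010101001 (pos 1001 (pos 10000010001 [ 1000221 ])))))
     (use (1ℤ ∷ 0ℤ ∷ 0ℤ ∷ -1ℤ ∷ []) (pos 10000001 (neg 100000001 (neg 10101 (pos 11 [ 102001 ]))))))
    (use (1ℤ ∷ 0ℤ ∷ 0ℤ ∷ -1ℤ ∷ []) (pos 1000001 (neg 10000001 (neg 1011010001 (both ([ 10021 ]) ([ 2000010021 ]))))))))
even-tree false true false =
  split i₀ (0ℤ , + 2)
  (use (-1ℤ ∷ 1ℤ ∷ 1ℤ ∷ 0ℤ ∷ []) (pos 10011 (pos 11010111 (pos 13110102 (pos 1110111 [ 20200121 ])))))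
  (split i₁ (1ℤ , 0ℤ)
   (split i₂ (-1ℤ , 1ℤ)
    (split i₂ (-1ℤ , 0ℤ)
     (use (-1ℤ ∷ 0ℤ ∷ 1ℤ ∷ 0ℤ ∷ []) (pos 10000001 (pos 11010100001 (both (neg 10000000001 [ 100021 ]) (neg 10000000001 [ 2000100021 ])))))
     (split i₃ (0ℤ , 1ℤ)
      (use (-1ℤ ∷ 1ℤ ∷ 1ℤ ∷ 0ℤ ∷ []) (neg 10001 (pos 101 (pos 10000100001 (pos 10101001001 [ 10000021 ])))))
      (use (-1ℤ ∷ 0ℤ ∷ 1ℤ ∷ 0ℤ ∷ []) (pos 100000001 (pos 100101 (pos 11 (neg 100000000001 [ 1002001 ])))))))
    (split i₄ (-1ℤ , -1ℤ)
     (split i₃ (0ℤ , 1ℤ)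
      (split i₄ (-1ℤ , -[1+ 1 ])
       (use (0ℤ ∷ 1ℤ ∷ 0ℤ ∷ -1ℤ ∷ []) (pos 1000000001 (neg 10000000001 (neg 101 (pos 111010000001 [ 200010000021 ])))))
       (use (-1ℤ ∷ 1ℤ ∷ 1ℤ ∷ 0ℤ ∷ []) (neg 100001 (pos 10001 (pos 100001000001 (pos 11 [ 100000201 ]))))))
      (use (0ℤ ∷ 1ℤ ∷ 0ℤ ∷ -1ℤ ∷ []) (pos 100000001 (neg 1000000001 (pos 11 (pos 1101000011 [ 1000201 ]))))))
     (split i₃ (1ℤ , + 3)
      (use (0ℤ ∷ 1ℤ ∷ 1ℤ ∷ -1ℤ ∷ []) (neg 10001 (pos 1001 (neg 11 (pos 101 [ 10000001 ])))))
      (use (1ℤ ∷ 0ℤ ∷ 0ℤ ∷ -1ℤ ∷ []) (pos 100000001 (neg 1000000001 (neg 101101000001 (neg 100000000001 [ 1000021 ]))))))))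
   (split i₁ (1ℤ , 1ℤ)
    (split i₃ (0ℤ , 1ℤ)
     (use (-1ℤ ∷ 1ℤ ∷ 1ℤ ∷ 0ℤ ∷ []) (pos 1001 (pos 11000101001 (pos 1000010001 (pos 1100101001 [ 1000221 ])))))
     (use (0ℤ ∷ 1ℤ ∷ 1ℤ ∷ 0ℤ ∷ []) (neg 10101 (neg 100000001 (pos 11 (neg 10000000001 [ 102001 ]))))))
    (use (0ℤ ∷ 1ℤ ∷ 1ℤ ∷ 0ℤ ∷ []) (neg 1110010001 (neg 10000001 (both (neg 1000000001 [ 10021 ]) (neg 1000000001 [ 200010021 ])))))))
even-tree false false true =
  split i₀ (0ℤ , + 2)
  (use (-1ℤ ∷ 0ℤ ∷ 1ℤ ∷ 1ℤ ∷ []) (neg 11100111 (pos 11010111 (pos 10110111 (pos 10000011 [ 2220121 ])))))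
  (split i₃ (-1ℤ , 0ℤ)
   (use (-1ℤ ∷ 0ℤ ∷ 0ℤ ∷ 1ℤ ∷ []) (pos 100001 (neg 1000001 (pos 101101001 (pos 100000001 [ 1021 ])))))
   (split i₄ (1ℤ , 0ℤ)
    (split i₁ (1ℤ , + 2)
     (split i₂ (-1ℤ , -1ℤ)
      (use (-1ℤ ∷ 0ℤ ∷ 1ℤ ∷ 0ℤ ∷ []) (pos 100000001 (pos 110101000001 (neg 10000000001 (pos 100000000001 [ 1000021 ])))))
      (use (-1ℤ ∷ 0ℤ ∷ 1ℤ ∷ 1ℤ ∷ []) (neg 101 (pos 11 (pos 10001 (neg 1001 [ 10000001 ]))))))
     (use (0ℤ ∷ 1ℤ ∷ 1ℤ ∷ 0ℤ ∷ []) (neg 11100100001 (neg 100000001 (neg 1000000001 (pos 10000000001 [ 100021 ]))))))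
    (use (0ℤ ∷ -1ℤ ∷ 0ℤ ∷ 1ℤ ∷ []) (pos 1000001 (neg 10000001 (neg 100000001 (neg 111010001 [ 10021 ])))))))
even-tree false false false =
  split i₀ (0ℤ , + 2)
  -- For a = 1 the norm is 3, too small for four non-zero coordinates. From the lowest digit on,
  -- twice a ≤ 1, once norm ≤ 2a + 1, and once each of e₁ ≥ 1 and e₂, e₃, e₄ ≤ -1 add up to -1 ≥ 0.
  (contra 1111012)
  (split i₃ (-1ℤ , 1ℤ)
   (use (-1ℤ ∷ 0ℤ ∷ 0ℤ ∷ 1ℤ ∷ []) (pos 100001 (neg 1000001 (pos 101101001 (neg 100000001 [ 1021 ])))))
   (split i₁ (1ℤ , 1ℤ)
    (split i₂ (-1ℤ , 0ℤ)
     (use (-1ℤ ∷ 0ℤ ∷ 1ℤ ∷ 0ℤ ∷ []) (pos 10000001 (pos 11010100001 (neg 1000000001 (neg 10000000001 [ 100021 ])))))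
     (split i₄ (-1ℤ , -[1+ 1 ])
      (use (0ℤ ∷ 1ℤ ∷ 0ℤ ∷ -1ℤ ∷ []) (pos 100000001 (neg 1000000001 (neg 10000000001 (pos 11101000001 [ 1000021 ])))))
      (use (-1ℤ ∷ 1ℤ ∷ 1ℤ ∷ 0ℤ ∷ []) (neg 1001 (pos 101 (pos 10001 (pos 11 [ 10000001 ])))))))
    (use (0ℤ ∷ 1ℤ ∷ 1ℤ ∷ 0ℤ ∷ []) (neg 1110010001 (neg 10000001 (neg 100000001 (neg 1000000001 [ 10021 ])))))))

-- Holds by evaluation of the checker; the signs are split so that the trees reduce. Of the
-- parameter only a ≥ 1 is assumed, so the eight evaluations serve every even k.
even-checked : ∀ s₂ s₃ s₄ → T (check (+ 2 , 0ℤ) even-basis (even-tree s₂ s₃ s₄) (facet (+ 2 , 0ℤ) 1ℤ s₂ s₃ s₄))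
even-checked true  true  true  = tt
even-checked true  true  false = tt
even-checked true  false true  = tt
even-checked true  false false = tt
even-checked false true  true  = tt
even-checked false true  false = tt
even-checked false false true  = tt
even-checked false false false = tt

module Even (c : ℕ) where

  open EvenFormulas c

  a b : ℤ
  a = 1ℤ + + c
  b = + 2 + + c

  orderℤ : ℤ
  orderℤ = polyℤ orderᶜ (+ c)

  gensℤ : Vec ℤ 3
  gensℤ = polyℤ g₂ᶜ (+ c) ∷ polyℤ g₃ᶜ (+ c) ∷ polyℤ g₄ᶜ (+ c) ∷ []

  order-cast : + order ≡ orderℤ
  order-cast = poly-cast orderᶜ c

  gens-cast : map +_ gens ≡ gensℤ
  gens-cast = cong₂ _∷_ (poly-cast g₂ᶜ c) (cong₂ _∷_ (poly-cast g₃ᶜ c) (cong (_∷ []) (poly-cast g₄ᶜ c)))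

  aₛ bₛ orderₛ modulusₛ : Polynomial 1 → Polynomial 1
  aₛ c = con 1ℤ :+ c
  bₛ c = con (+ 2) :+ c
  orderₛ = polyₛ orderᶜ
  modulusₛ c = con (+ 2) :* antipodeₛ (aₛ c) (bₛ c)

  gensₛ : Polynomial 1 → Vec (Polynomial 1) 4
  gensₛ c = con 1ℤ ∷ polyₛ g₂ᶜ c ∷ polyₛ g₃ᶜ c ∷ polyₛ g₄ᶜ c ∷ []

  -- Each basis vector has norm 4a + 1 = 2k + 1. Paired with the generators, the four give a, 1 - a,
  -- a - 1 and 0 times the order.
  periods : V.All (λ p → orderℤ ∣ map _⟨ a ⟩ p ∙ (1ℤ ∷ gensℤ)) even-basis
  periods =
        divides (1ℤ + + c) (solve 1 (λ c →
          map (affineₛ (aₛ c)) ((1ℤ , 0ℤ) ∷ (1ℤ , 0ℤ) ∷ (1ℤ , 0ℤ) ∷ (1ℤ , 1ℤ) ∷ []) ∙ₛ gensₛ c := (con 1ℤ :+ c) :* orderₛ c) refl (+ c))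
    V.∷ divides (- + c) (solve 1 (λ c →
          map (affineₛ (aₛ c)) ((1ℤ , 0ℤ) ∷ (1ℤ , 0ℤ) ∷ (-1ℤ , 0ℤ) ∷ (-1ℤ , -1ℤ) ∷ []) ∙ₛ gensₛ c := :- c :* orderₛ c) refl (+ c))
    V.∷ divides (+ c) (solve 1 (λ c →
          map (affineₛ (aₛ c)) ((1ℤ , 0ℤ) ∷ (-1ℤ , 0ℤ) ∷ (1ℤ , 1ℤ) ∷ (1ℤ , 0ℤ) ∷ []) ∙ₛ gensₛ c := c :* orderₛ c) refl (+ c))
    V.∷ divides 0ℤ (solve 1 (λ c →
          map (affineₛ (aₛ c)) ((1ℤ , 1ℤ) ∷ (1ℤ , -1ℤ) ∷ (-1ℤ , -1ℤ) ∷ (1ℤ , 0ℤ) ∷ []) ∙ₛ gensₛ c := con 0ℤ :* orderₛ c) refl (+ c))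
    V.∷ V.[]

  factorisation : orderℤ ≡ + 2 * a * (+ 2 * antipode a b)
  factorisation = solve 1 (λ c → orderₛ c := con (+ 2) :* aₛ c :* modulusₛ c) refl (+ c)

  -- Modulo 2z the generators are 1, -1, h and h + 2a.
  images : V.All (Image a b) (1ℤ ∷ gensℤ)
  images =
        ((1ℤ ∷ 0ℤ ∷ 0ℤ ∷ []) , s≤s z≤n , divides 0ℤ (solve 1 (λ c →
          con 1ℤ :- (con 1ℤ ∷ con 0ℤ ∷ con 0ℤ ∷ []) ∙ₛ quotient-gensₛ (aₛ c) (bₛ c)
            := con 0ℤ :* modulusₛ c) refl (+ c)))
    V.∷ ((-1ℤ ∷ 0ℤ ∷ 0ℤ ∷ []) , s≤s z≤n , divides 1ℤ (solve 1 (λ c →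
          polyₛ g₂ᶜ c :- (con -1ℤ ∷ con 0ℤ ∷ con 0ℤ ∷ []) ∙ₛ quotient-gensₛ (aₛ c) (bₛ c)
            := con 1ℤ :* modulusₛ c) refl (+ c)))
    V.∷ ((0ℤ ∷ 1ℤ ∷ 0ℤ ∷ []) , s≤s z≤n , divides (+ c) (solve 1 (λ c →
          polyₛ g₃ᶜ c :- (con 0ℤ ∷ con 1ℤ ∷ con 0ℤ ∷ []) ∙ₛ quotient-gensₛ (aₛ c) (bₛ c)
            := c :* modulusₛ c) refl (+ c)))
    V.∷ ((0ℤ ∷ 0ℤ ∷ 1ℤ ∷ []) , s≤s z≤n , divides (+ c) (solve 1 (λ c →
          polyₛ g₄ᶜ c :- (con 0ℤ ∷ con 0ℤ ∷ con 1ℤ ∷ []) ∙ₛ quotient-gensₛ (aₛ c) (bₛ c)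
            := c :* modulusₛ c) refl (+ c)))
    V.∷ V.[]

  kₛ : Polynomial 1 → Polynomial 1
  kₛ c = (con 1ℤ :+ c) :* con (+ 2)

  radius : (+ 2 , 0ℤ) ⟨ a ⟩ ≡ + k
  radius = trans (solve 1 (λ c → affineₛ (aₛ c) (+ 2 , 0ℤ) := kₛ c) refl (+ c)) (sym (pos-* (suc c) 2))

  halves : + k ≡ a + b - 1ℤ
  halves = trans (pos-* (suc c) 2) (solve 1 (λ c → kₛ c := aₛ c :+ bₛ c :- con 1ℤ) refl (+ c))

  diameter : HasDiameter order (1 ∷ gens) k
  diameter =
      connected-within order-cast gens-cast reachable
    , vertex 0ℤ , vertex (antipode a b)
    -- Both a - 1 and b - 2 compute to c, and b - a is 1.
    , antipode-far a b (nonneg c) (nonneg c)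
        (subst (0ℤ ≤ᶻ_) (solve 1 (λ c → con 1ℤ := bₛ c :- aₛ c) refl (+ c)) (nonneg 1))
        halves order-cast gens-cast factorisation images
    where open Covering (+ 2 , 0ℤ) 1ℤ even-basis even-tree even-checked radius (+≤+ (s≤s z≤n)) gensℤ periods

  result : HasDiameter (L8 k) (gens8 k) k
  result = subst₂ (λ n gs → HasDiameter n gs k) (sym L8-k) (sym gens8-k) diameter

-- The case of odd k.

odd-basis : Vec (Vec Affine 4) 4
odd-basis =
    ((1ℤ , 0ℤ) ∷ (1ℤ , 0ℤ) ∷ (-1ℤ , 1ℤ) ∷ (-1ℤ , 0ℤ) ∷ [])
  ∷ ((1ℤ , 0ℤ) ∷ (-1ℤ , 0ℤ) ∷ (1ℤ , 0ℤ) ∷ (1ℤ , -1ℤ) ∷ [])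
  ∷ ((1ℤ , 0ℤ) ∷ (-1ℤ , 0ℤ) ∷ (-1ℤ , 0ℤ) ∷ (-1ℤ , 1ℤ) ∷ [])
  ∷ ((1ℤ , 1ℤ) ∷ (-1ℤ , 1ℤ) ∷ (-1ℤ , 1ℤ) ∷ (1ℤ , 0ℤ) ∷ [])
  ∷ []

-- Here a ≥ 2, and k = 3 takes no branch of its own: no tree splits on a.
odd-tree : Bool → Bool → Bool → Tree 4 4
odd-tree true true true =
  split i₄ (1ℤ , -1ℤ)
  (split i₁ (1ℤ , 1ℤ)
   (split i₂ (1ℤ , 1ℤ)
    (split i₃ (1ℤ , + 2)
     (use (1ℤ ∷ 1ℤ ∷ -1ℤ ∷ 0ℤ ∷ []) (neg 1001 (neg 101 (neg 11 (neg 10001 [ 1000001 ])))))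
     (use (0ℤ ∷ 1ℤ ∷ 0ℤ ∷ -1ℤ ∷ []) (pos 10000001 (pos 100000001 (neg 10110100001 (pos 10000000001 [ 100021 ]))))))
    (split i₂ (1ℤ , + 2)
     (split i₃ (0ℤ , 1ℤ)
      (use (1ℤ ∷ 0ℤ ∷ -1ℤ ∷ 1ℤ ∷ []) (neg 10001 (pos 1001 (pos 1010000000001 (neg 100001 [ 10000221 ])))))
      (use (1ℤ ∷ 0ℤ ∷ -1ℤ ∷ 0ℤ ∷ []) (pos 100000001 (neg 1000000000101 (pos 11 (pos 100000000001 [ 1002001 ]))))))
     (use (1ℤ ∷ 0ℤ ∷ -1ℤ ∷ 0ℤ ∷ []) (pos 10000001 (neg 11010100001 (both (pos 10000000001 [ 100021 ]) (pos 10000000001 [ 2000100021 ])))))))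
   (split i₁ (1ℤ , + 2)
    (split i₃ (0ℤ , 1ℤ)
     (use (1ℤ ∷ 0ℤ ∷ -1ℤ ∷ 1ℤ ∷ []) (pos 1001 (neg 11000101001 (pos 101000000001 (neg 10001 [ 1000221 ])))))
     (use (1ℤ ∷ 1ℤ ∷ 0ℤ ∷ 0ℤ ∷ []) (neg 100000000101 (pos 100000001 (pos 11 (pos 10000000001 [ 102001 ]))))))
    (use (1ℤ ∷ 1ℤ ∷ 0ℤ ∷ 0ℤ ∷ []) (neg 1110010001 (pos 10000001 (both (pos 1000000001 [ 10021 ]) (pos 1000000001 [ 200010021 ])))))))
  (split i₄ (1ℤ , 1ℤ)
   (split i₄ (1ℤ , 0ℤ)
    (split i₃ (0ℤ , 1ℤ)
     (use (1ℤ ∷ 0ℤ ∷ -1ℤ ∷ 1ℤ ∷ []) (neg 1100110001 (neg 1010110001 (pos 101000000001 (pos 10001 [ 1000221 ])))))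
     (split i₂ (0ℤ , 1ℤ)
      (use (0ℤ ∷ 1ℤ ∷ 0ℤ ∷ 0ℤ ∷ []) (neg 1001100101 (pos 1001000000001 (neg 1101100001 (pos 100001 [ 10002021 ])))))
      (use (0ℤ ∷ 0ℤ ∷ -1ℤ ∷ 1ℤ ∷ []) (pos 100000001 (pos 11 (pos 101 (neg 1000000001001 [ 1200001 ])))))))
    (split i₁ (1ℤ , 0ℤ)
     (use (0ℤ ∷ 0ℤ ∷ -1ℤ ∷ 1ℤ ∷ []) (pos 10000001 (both (both (neg 100000001001 [ 100201 ]) (neg 100000001001 [ 2000100201 ])) (both (neg 100000001001 [ 200100201 ]) (neg 100000001001 [ 1000021 ])))))
     (use (0ℤ ∷ 0ℤ ∷ 0ℤ ∷ 1ℤ ∷ []) (neg 1100100101 (pos 100100000001 (pos 101000000001 (pos 101 [ 100021 ])))))))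
   (use (0ℤ ∷ 0ℤ ∷ -1ℤ ∷ 1ℤ ∷ []) (pos 100001 (both (both (neg 11101001 [ 1021 ]) (neg 11101001 [ 20001021 ])) (both (neg 11101001 [ 2001021 ]) (neg 11101001 [ 22001021 ]))))))
odd-tree true true false =
  split i₁ (1ℤ , 0ℤ)
  (split i₂ (1ℤ , 0ℤ)
   (split i₃ (1ℤ , 1ℤ)
    (split i₄ (-1ℤ , -1ℤ)
     (use (0ℤ ∷ 0ℤ ∷ 1ℤ ∷ -1ℤ ∷ []) (pos 10000001 (pos 100000001 (pos 1000000001 (pos 1110100001 [ 100021 ])))))
     (use (1ℤ ∷ 1ℤ ∷ 0ℤ ∷ -1ℤ ∷ []) (neg 10001 (neg 1001 (neg 101 (pos 11 [ 1000001 ]))))))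
    (use (0ℤ ∷ 1ℤ ∷ 0ℤ ∷ -1ℤ ∷ []) (pos 1000001 (pos 10000001 (neg 1011010001 (neg 1000000001 [ 10021 ]))))))
   (split i₂ (1ℤ , 1ℤ)
    (split i₃ (0ℤ , 1ℤ)
     (use (1ℤ ∷ 0ℤ ∷ 0ℤ ∷ 0ℤ ∷ []) (neg 10001 (pos 1001 (pos 101000000001 (pos 1010101001 [ 1000221 ])))))
     (use (1ℤ ∷ 0ℤ ∷ -1ℤ ∷ 0ℤ ∷ []) (pos 10000001 (neg 100000000101 (pos 11 (neg 10000000001 [ 102001 ]))))))
    (use (1ℤ ∷ 0ℤ ∷ -1ℤ ∷ 0ℤ ∷ []) (pos 1000001 (neg 1101010001 (both (neg 1000000001 [ 10021 ]) (neg 1000000001 [ 200010021 ])))))))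
  (split i₁ (1ℤ , 1ℤ)
   (split i₃ (0ℤ , 1ℤ)
    (use (1ℤ ∷ 0ℤ ∷ 0ℤ ∷ 0ℤ ∷ []) (pos 1001 (neg 1100011001 (pos 10100000001 (pos 110011001 [ 100221 ])))))
    (use (1ℤ ∷ 1ℤ ∷ 0ℤ ∷ 0ℤ ∷ []) (neg 10000000101 (pos 10000001 (pos 11 (neg 1000000001 [ 12001 ]))))))
   (use (1ℤ ∷ 1ℤ ∷ 0ℤ ∷ 0ℤ ∷ []) (neg 111001001 (pos 1000001 (both (neg 100000001 [ 1021 ]) (neg 100000001 [ 20001021 ]))))))
odd-tree true false true =
  split i₃ (-1ℤ , + 2)
  (split i₂ (0ℤ , 1ℤ)
   (split i₃ (-1ℤ , 1ℤ)
    (split i₁ (1ℤ , 0ℤ)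
     (use (0ℤ ∷ -1ℤ ∷ 0ℤ ∷ 1ℤ ∷ []) (pos 10000001 (neg 1001 (pos 10110100001 (both ([ 200100201 ]) ([ 1000021 ]))))))
     (use (0ℤ ∷ 0ℤ ∷ 1ℤ ∷ 0ℤ ∷ []) (pos 11 (pos 100100000001 (pos 10100100011 (pos 110000000001 [ 100201 ]))))))
    (use (0ℤ ∷ 0ℤ ∷ 0ℤ ∷ 1ℤ ∷ []) (neg 1010011001 (pos 110000011 (pos 11 (neg 11011001 [ 100201 ]))))))
   (split i₃ (-1ℤ , 1ℤ)
    (use (0ℤ ∷ -1ℤ ∷ 0ℤ ∷ 1ℤ ∷ []) (pos 1000001 (pos 101 (pos 1001010101 (both ([ 10021 ]) ([ 2000010021 ]))))))
    (split i₄ (0ℤ , 1ℤ)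
     (use (1ℤ ∷ 0ℤ ∷ 0ℤ ∷ 0ℤ ∷ []) (neg 10000111001 (neg 10010110001 (pos 101 (pos 11000000101 [ 1000021 ])))))
     (use (0ℤ ∷ -1ℤ ∷ 0ℤ ∷ 1ℤ ∷ []) (pos 10000001 (pos 1001 (pos 1000000201 (pos 11 [ 120001 ]))))))))
  (split i₄ (1ℤ , 0ℤ)
   (split i₁ (1ℤ , + 2)
    (split i₂ (1ℤ , + 2)
     (use (1ℤ ∷ 0ℤ ∷ -1ℤ ∷ 1ℤ ∷ []) (neg 101 (neg 11 (pos 10001 (neg 1001 [ 1000001 ])))))
     (use (1ℤ ∷ 0ℤ ∷ -1ℤ ∷ 0ℤ ∷ []) (pos 10000001 (neg 11010100001 (neg 1000000001 (pos 10000000001 [ 100021 ]))))))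
    (use (1ℤ ∷ 1ℤ ∷ 0ℤ ∷ 0ℤ ∷ []) (neg 1110010001 (pos 10000001 (neg 100000001 (pos 1000000001 [ 10021 ]))))))
   (split i₂ (0ℤ , 1ℤ)
    (split i₄ (1ℤ , 1ℤ)
     (use (0ℤ ∷ 0ℤ ∷ 0ℤ ∷ 1ℤ ∷ []) (neg 1100101001 (pos 1100010001 (pos 10001 (pos 1001 [ 1000221 ])))))
     (use (0ℤ ∷ 0ℤ ∷ -1ℤ ∷ 1ℤ ∷ []) (pos 10000001 (neg 101 (neg 1000000001 (neg 1110100001 [ 200100021 ]))))))
    (use (0ℤ ∷ 0ℤ ∷ -1ℤ ∷ 1ℤ ∷ []) (pos 1000001 (pos 11 (neg 100000001 (neg 101010011 [ 10201 ])))))))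
odd-tree true false false =
  split i₃ (-1ℤ , 1ℤ)
  (split i₂ (0ℤ , 1ℤ)
   (split i₃ (-1ℤ , 0ℤ)
    (use (0ℤ ∷ -1ℤ ∷ 0ℤ ∷ 1ℤ ∷ []) (pos 1000001 (neg 101 (pos 1011010001 (neg 1000000001 [ 20010021 ])))))
    (use (0ℤ ∷ 0ℤ ∷ 1ℤ ∷ 0ℤ ∷ []) (neg 1010011001 (pos 10010000001 (pos 11 (pos 11011001 [ 100201 ]))))))
   (use (0ℤ ∷ -1ℤ ∷ 0ℤ ∷ 1ℤ ∷ []) (pos 100001 (pos 11 (pos 100101011 (neg 100000001 [ 1201 ]))))))
  (split i₁ (1ℤ , 1ℤ)
   (split i₄ (-1ℤ , 0ℤ)
    (use (0ℤ ∷ 0ℤ ∷ 1ℤ ∷ -1ℤ ∷ []) (pos 1000001 (pos 10000001 (neg 100000001 (pos 111010001 [ 10021 ])))))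
    (split i₂ (1ℤ , 1ℤ)
     (use (1ℤ ∷ 0ℤ ∷ 0ℤ ∷ 0ℤ ∷ []) (neg 1001 (neg 11 (pos 10001 (pos 101 [ 1000001 ])))))
     (use (1ℤ ∷ 0ℤ ∷ -1ℤ ∷ 0ℤ ∷ []) (pos 10000001 (neg 11010100001 (neg 1000000001 (neg 10000000001 [ 100021 ])))))))
   (use (1ℤ ∷ 1ℤ ∷ 0ℤ ∷ 0ℤ ∷ []) (neg 111001001 (pos 1000001 (neg 10000001 (neg 100000001 [ 1021 ]))))))
odd-tree false true true =
  split i₂ (-1ℤ , 0ℤ)
  (split i₂ (-1ℤ , -1ℤ)
   (use (-1ℤ ∷ 0ℤ ∷ 1ℤ ∷ 0ℤ ∷ []) (pos 100001 (pos 110101001 (pos 10000001 (both ([ 1021 ]) ([ 200001021 ]))))))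
   (split i₄ (0ℤ , 1ℤ)
    (use (0ℤ ∷ 1ℤ ∷ 1ℤ ∷ -1ℤ ∷ []) (neg 1100011001 (pos 101 (neg 1001011001 (pos 11000000001 [ 100021 ])))))
    (use (-1ℤ ∷ 0ℤ ∷ 1ℤ ∷ 0ℤ ∷ []) (pos 1000001 (pos 101010011 (pos 100000001 (pos 11 [ 12001 ])))))))
  (split i₁ (1ℤ , 1ℤ)
   (split i₄ (1ℤ , 0ℤ)
    (split i₃ (1ℤ , 1ℤ)
     (use (0ℤ ∷ 1ℤ ∷ 0ℤ ∷ 0ℤ ∷ []) (neg 1001 (pos 10001 (neg 11 (neg 101 [ 1000001 ])))))
     (use (0ℤ ∷ 1ℤ ∷ 0ℤ ∷ -1ℤ ∷ []) (pos 10000001 (neg 100000001 (neg 10110100001 (pos 10000000001 [ 100021 ]))))))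
    (split i₃ (0ℤ , 1ℤ)
     (split i₄ (1ℤ , 1ℤ)
      (use (0ℤ ∷ 0ℤ ∷ 0ℤ ∷ 1ℤ ∷ []) (neg 10001 (pos 10101001001 (pos 1010000000001 (pos 1001 [ 10000221 ])))))
      (use (0ℤ ∷ 0ℤ ∷ -1ℤ ∷ 1ℤ ∷ []) (pos 100000001 (neg 1000000001 (neg 101 (neg 11101000001 [ 20001000021 ]))))))
     (use (0ℤ ∷ 0ℤ ∷ -1ℤ ∷ 1ℤ ∷ []) (pos 10000001 (neg 100000001 (pos 11 (neg 110100011 [ 100201 ])))))))
   (split i₁ (1ℤ , + 2)
    (split i₃ (0ℤ , 1ℤ)
     (use (0ℤ ∷ 0ℤ ∷ 0ℤ ∷ 1ℤ ∷ []) (pos 1001 (pos 11000101001 (pos 101000000001 (neg 1100101001 [ 1000221 ])))))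
     (use (1ℤ ∷ 1ℤ ∷ 0ℤ ∷ 0ℤ ∷ []) (neg 100000000101 (neg 100000001 (pos 11 (pos 10000000001 [ 102001 ]))))))
    (use (1ℤ ∷ 1ℤ ∷ 0ℤ ∷ 0ℤ ∷ []) (neg 1110010001 (neg 10000001 (both (pos 1000000001 [ 10021 ]) (pos 1000000001 [ 200010021 ])))))))
odd-tree false true false =
  split i₁ (1ℤ , 0ℤ)
  (split i₃ (1ℤ , 0ℤ)
   (split i₄ (-1ℤ , 0ℤ)
    (use (0ℤ ∷ 0ℤ ∷ 1ℤ ∷ -1ℤ ∷ []) (pos 1000001 (neg 10000001 (pos 100000001 (pos 111010001 [ 10021 ])))))
    (split i₂ (-1ℤ , -1ℤ)
     (use (-1ℤ ∷ 0ℤ ∷ 1ℤ ∷ 0ℤ ∷ []) (pos 10000001 (pos 11010100001 (pos 1000000001 (neg 10000000001 [ 100021 ])))))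
     (use (0ℤ ∷ 1ℤ ∷ 1ℤ ∷ -1ℤ ∷ []) (neg 10001 (pos 11 (neg 1001 (pos 101 [ 1000001 ])))))))
   (use (0ℤ ∷ 1ℤ ∷ 0ℤ ∷ -1ℤ ∷ []) (pos 100001 (neg 1000001 (neg 101101001 (neg 100000001 [ 1021 ]))))))
  (split i₁ (1ℤ , 1ℤ)
   (split i₃ (0ℤ , 1ℤ)
    (use (0ℤ ∷ 0ℤ ∷ 1ℤ ∷ 0ℤ ∷ []) (pos 1001 (pos 1100011001 (pos 10100000001 (pos 110011001 [ 100221 ])))))
    (use (1ℤ ∷ 1ℤ ∷ 0ℤ ∷ 0ℤ ∷ []) (neg 10000000101 (neg 10000001 (pos 11 (neg 1000000001 [ 12001 ]))))))
   (use (1ℤ ∷ 1ℤ ∷ 0ℤ ∷ 0ℤ ∷ []) (neg 111001001 (neg 1000001 (both (neg 100000001 [ 1021 ]) (neg 100000001 [ 20001021 ]))))))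
odd-tree false false true =
  split i₁ (1ℤ , + 2)
  (split i₂ (-1ℤ , 1ℤ)
   (split i₂ (-1ℤ , 0ℤ)
    (use (-1ℤ ∷ 0ℤ ∷ 1ℤ ∷ 0ℤ ∷ []) (pos 1000001 (pos 1101010001 (neg 100000001 (both ([ 10021 ]) ([ 2000010021 ]))))))
    (split i₄ (0ℤ , 1ℤ)
     (use (0ℤ ∷ 0ℤ ∷ 1ℤ ∷ 0ℤ ∷ []) (neg 11000101001 (pos 101 (pos 10010101001 (pos 110000000001 [ 1000021 ])))))
     (use (-1ℤ ∷ 0ℤ ∷ 1ℤ ∷ 0ℤ ∷ []) (pos 10000001 (pos 1010100011 (neg 1000000001 (pos 11 [ 102001 ])))))))
   (split i₃ (-1ℤ , 1ℤ)
    (split i₃ (-1ℤ , 0ℤ)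
     (use (0ℤ ∷ -1ℤ ∷ 0ℤ ∷ 1ℤ ∷ []) (pos 10000001 (neg 100000001 (pos 10110100001 (both ([ 100021 ]) ([ 20000100021 ]))))))
     (split i₄ (0ℤ , 1ℤ)
      (use (0ℤ ∷ 0ℤ ∷ 1ℤ ∷ 0ℤ ∷ []) (neg 101001001001 (pos 10001 (pos 101 (pos 101000010001 [ 10000021 ])))))
      (use (0ℤ ∷ -1ℤ ∷ 0ℤ ∷ 1ℤ ∷ []) (pos 100000001 (neg 1000000001 (pos 1101000011 (pos 11 [ 1002001 ])))))))
    (split i₄ (1ℤ , 1ℤ)
     (use (0ℤ ∷ 0ℤ ∷ 0ℤ ∷ 1ℤ ∷ []) (neg 10001 (pos 1001 (pos 101 (neg 11 [ 1000001 ])))))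
     (use (0ℤ ∷ 0ℤ ∷ -1ℤ ∷ 1ℤ ∷ []) (pos 10000001 (neg 100000001 (neg 1000000001 (neg 1110100001 [ 100021 ]))))))))
  (use (1ℤ ∷ 1ℤ ∷ 0ℤ ∷ 0ℤ ∷ []) (neg 11100101 (neg 100001 (neg 1000001 (pos 10000001 [ 121 ])))))
odd-tree false false false =
  split i₄ (-1ℤ , 1ℤ)
  (use (0ℤ ∷ 0ℤ ∷ 1ℤ ∷ -1ℤ ∷ []) (pos 10001 (neg 100001 (neg 1000001 (pos 1110101 [ 121 ])))))
  (split i₁ (1ℤ , 1ℤ)
   (split i₂ (-1ℤ , 0ℤ)
    (use (-1ℤ ∷ 0ℤ ∷ 1ℤ ∷ 0ℤ ∷ []) (pos 1000001 (pos 1101010001 (neg 100000001 (neg 1000000001 [ 10021 ])))))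
    (split i₃ (-1ℤ , 0ℤ)
     (use (0ℤ ∷ -1ℤ ∷ 0ℤ ∷ 1ℤ ∷ []) (pos 10000001 (neg 100000001 (pos 10110100001 (neg 10000000001 [ 100021 ])))))
     (use (0ℤ ∷ 0ℤ ∷ 1ℤ ∷ 0ℤ ∷ []) (neg 1001 (pos 101 (pos 11 (pos 10001 [ 1000001 ])))))))
   (use (1ℤ ∷ 1ℤ ∷ 0ℤ ∷ 0ℤ ∷ []) (neg 111001001 (neg 1000001 (neg 10000001 (neg 100000001 [ 1021 ]))))))

odd-checked : ∀ s₂ s₃ s₄ → T (check (+ 2 , -1ℤ) odd-basis (odd-tree s₂ s₃ s₄) (facet (+ 2 , -1ℤ) (+ 2) s₂ s₃ s₄))
odd-checked true  true  true  = tt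
odd-checked true  true  false = tt
odd-checked true  false true  = tt
odd-checked true  false false = tt
odd-checked false true  true  = tt
odd-checked false true  false = tt
odd-checked false false true  = tt
odd-checked false false false = tt

module Odd (c : ℕ) where

  open OddFormulas c

  a b : ℤ
  a = + 2 + + c
  b = + 2 + + c

  orderℤ : ℤ
  orderℤ = polyℤ orderᶜ (+ c)

  gensℤ : Vec ℤ 3
  gensℤ = polyℤ g₂ᶜ (+ c) ∷ polyℤ g₃ᶜ (+ c) ∷ polyℤ g₄ᶜ (+ c) ∷ []

  order-cast : + order ≡ orderℤ
  order-cast = poly-cast orderᶜ c

  gens-cast : map +_ gens ≡ gensℤ
  gens-cast = cong₂ _∷_ (poly-cast g₂ᶜ c) (cong₂ _∷_ (poly-cast g₃ᶜ c) (cong (_∷ []) (poly-cast g₄ᶜ c)))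

  aₛ bₛ orderₛ modulusₛ : Polynomial 1 → Polynomial 1
  aₛ c = con (+ 2) :+ c
  bₛ c = con (+ 2) :+ c
  orderₛ = polyₛ orderᶜ
  modulusₛ c = con (+ 2) :* antipodeₛ (aₛ c) (bₛ c)

  gensₛ : Polynomial 1 → Vec (Polynomial 1) 4
  gensₛ c = con 1ℤ ∷ polyₛ g₂ᶜ c ∷ polyₛ g₃ᶜ c ∷ polyₛ g₄ᶜ c ∷ []

  -- Each basis vector has norm 4a - 1 = 2k + 1. Paired with the generators, the four give 2 - a, a
  -- - 2, 1 - a and 0 times the order.
  periods : V.All (λ p → orderℤ ∣ map _⟨ a ⟩ p ∙ (1ℤ ∷ gensℤ)) odd-basis
  periods =
        divides (- + c) (solve 1 (λ c →
          map (affineₛ (aₛ c)) ((1ℤ , 0ℤ) ∷ (1ℤ , 0ℤ) ∷ (-1ℤ , 1ℤ) ∷ (-1ℤ , 0ℤ) ∷ []) ∙ₛ gensₛ c := :- c :* orderₛ c) refl (+ c))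
    V.∷ divides (+ c) (solve 1 (λ c →
          map (affineₛ (aₛ c)) ((1ℤ , 0ℤ) ∷ (-1ℤ , 0ℤ) ∷ (1ℤ , 0ℤ) ∷ (1ℤ , -1ℤ) ∷ []) ∙ₛ gensₛ c := c :* orderₛ c) refl (+ c))
    V.∷ divides (- (1ℤ + + c)) (solve 1 (λ c →
          map (affineₛ (aₛ c)) ((1ℤ , 0ℤ) ∷ (-1ℤ , 0ℤ) ∷ (-1ℤ , 0ℤ) ∷ (-1ℤ , 1ℤ) ∷ []) ∙ₛ gensₛ c := :- (con 1ℤ :+ c) :* orderₛ c) refl (+ c))
    V.∷ divides 0ℤ (solve 1 (λ c →
          map (affineₛ (aₛ c)) ((1ℤ , 1ℤ) ∷ (-1ℤ , 1ℤ) ∷ (-1ℤ , 1ℤ) ∷ (1ℤ , 0ℤ) ∷ []) ∙ₛ gensₛ c := con 0ℤ :* orderₛ c) refl (+ c))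
    V.∷ V.[]

  factorisation : orderℤ ≡ + 2 * a * (+ 2 * antipode a b)
  factorisation = solve 1 (λ c → orderₛ c := con (+ 2) :* aₛ c :* modulusₛ c) refl (+ c)

  -- Modulo 2z the generators are 1, 1, -(h + 2a) and -h.
  images : V.All (Image a b) (1ℤ ∷ gensℤ)
  images =
        ((1ℤ ∷ 0ℤ ∷ 0ℤ ∷ []) , s≤s z≤n , divides 0ℤ (solve 1 (λ c →
          con 1ℤ :- (con 1ℤ ∷ con 0ℤ ∷ con 0ℤ ∷ []) ∙ₛ quotient-gensₛ (aₛ c) (bₛ c)
            := con 0ℤ :* modulusₛ c) refl (+ c)))
    V.∷ ((1ℤ ∷ 0ℤ ∷ 0ℤ ∷ []) , s≤s z≤n , divides 1ℤ (solve 1 (λ c →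
          polyₛ g₂ᶜ c :- (con 1ℤ ∷ con 0ℤ ∷ con 0ℤ ∷ []) ∙ₛ quotient-gensₛ (aₛ c) (bₛ c)
            := con 1ℤ :* modulusₛ c) refl (+ c)))
    V.∷ ((0ℤ ∷ 0ℤ ∷ -1ℤ ∷ []) , s≤s z≤n , divides (1ℤ + + c) (solve 1 (λ c →
          polyₛ g₃ᶜ c :- (con 0ℤ ∷ con 0ℤ ∷ con -1ℤ ∷ []) ∙ₛ quotient-gensₛ (aₛ c) (bₛ c)
            := (con 1ℤ :+ c) :* modulusₛ c) refl (+ c)))
    V.∷ ((0ℤ ∷ -1ℤ ∷ 0ℤ ∷ []) , s≤s z≤n , divides (1ℤ + + c) (solve 1 (λ c →
          polyₛ g₄ᶜ c :- (con 0ℤ ∷ con -1ℤ ∷ con 0ℤ ∷ []) ∙ₛ quotient-gensₛ (aₛ c) (bₛ c)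
            := (con 1ℤ :+ c) :* modulusₛ c) refl (+ c)))
    V.∷ V.[]

  kₛ : Polynomial 1 → Polynomial 1
  kₛ c = con 1ℤ :+ (con 1ℤ :+ c) :* con (+ 2)

  radius : (+ 2 , -1ℤ) ⟨ a ⟩ ≡ + k
  radius = trans (solve 1 (λ c → affineₛ (aₛ c) (+ 2 , -1ℤ) := kₛ c) refl (+ c)) (sym (cong (λ i → 1ℤ + i) (pos-* (suc c) 2)))

  halves : + k ≡ a + b - 1ℤ
  halves = trans (cong (λ i → 1ℤ + i) (pos-* (suc c) 2)) (solve 1 (λ c → kₛ c := aₛ c :+ bₛ c :- con 1ℤ) refl (+ c))

  diameter : HasDiameter order (1 ∷ gens) k
  diameter =
      connected-within order-cast gens-cast reachable
    , vertex 0ℤ , vertex (antipode a b)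
    -- Here a - 1 computes to c + 1 and b - 2 to c, and b equals a.
    , antipode-far a b (nonneg (suc c)) (nonneg c)
        (subst (0ℤ ≤ᶻ_) (solve 1 (λ c → con 0ℤ := bₛ c :- aₛ c) refl (+ c)) (nonneg 0))
        halves order-cast gens-cast factorisation images
    where open Covering (+ 2 , -1ℤ) (+ 2) odd-basis odd-tree odd-checked radius (+≤+ (s≤s (s≤s z≤n))) gensℤ periods

  result : HasDiameter (L8 k) (gens8 k) k
  result = subst₂ (λ n gs → HasDiameter n gs k) (sym L8-k) (sym gens8-k) diameter

-- Both parities together.

by-parity : ∀ r q → r < 2 → 2 ≤ r ℕ.+ q ℕ.* 2 →
  HasDiameter (L8 (r ℕ.+ q ℕ.* 2)) (gens8 (r ℕ.+ q ℕ.* 2)) (r ℕ.+ q ℕ.* 2)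
-- With q = c + 1 the number r + 2q computes to the `k` of `Even` or `Odd` at c; q = 0 would give a
-- number below 2.
by-parity 0 (suc c) _ _ = Even.result c
by-parity 1 (suc c) _ _ = Odd.result c
by-parity 1 zero _ (s≤s ())
by-parity (suc (suc _)) _ (s≤s (s≤s ())) _

circulant-diameter : ∀ k → 2 ≤ k → HasDiameter (L8 k) (gens8 k) k
circulant-diameter k 2≤k = subst (λ k → HasDiameter (L8 k) (gens8 k) k) (sym eq)
  (by-parity (k ℕ.% 2) (k ℕ./ 2) (m%n<n k 2) (subst (2 ≤_) eq 2≤k))
  where
  eq : k ≡ k ℕ.% 2 ℕ.+ k ℕ./ 2 ℕ.* 2
  eq = m≡m%n+[m/n]*n k 2

theorem1 : (k : ℕ) → 2 ≤ k →
    (∃[ gs ] HasDiameter (L8 k) gs k) × HasDiameter (L8 k) (gens8 k) k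
theorem1 k 2≤k = (gens8 k , circulant-diameter k 2≤k) , circulant-diameter k 2≤k
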